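{- Let $k\ge2$. For $n\ge0$ let $ud(n)$, $dd(n)$, $uu(n)$, $du(n)$ be, respectively, the numbers of up-down, down-down, up-up and down-up permutations of length $n$ that avoid $1\mbox{ - }3\mbox{ - }2$ and contain the pattern $1\mbox{ - }2\mbox{ - }\cdots\mbox{ - }k$ exactly once, with generating functions $UD(x)=\sum_n ud(n)x^n$, $DD(x)=\sum_n dd(n)x^n$, $UU(x)=\sum_n uu(n)x^n$, $DU(x)=\sum_n du(n)x^n$. Writing $U_r$ for $U_r\!\left(\frac1{2x}\right)$, (1) $UD(x)=\dfrac{x}{U_{k-1}^2}$; (2) $DD(x)=\dfrac{1}{U_{k-1}}\displaystyle\sum_{m=0}^{k-2}\frac{x^{k-1-m}\bigl(x^{m+1}+U_{m-1}\bigr)}{U_mU_{m+1}}$; (3) $UU(x)=\dfrac{1}{U_{k-1}^2}$; (4) $DU(x)=\dfrac{1}{xU_{k-1}}\displaystyle\sum_{m=0}^{k-2}\frac{x^{k-1-m}\bigl(x^{m+1}+U_{m-1}\bigr)}{U_mU_{m+1}}$.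
   Context: A permutation of length $n$ is a word $\pi_1\cdots\pi_n$ containing each of $1,\dots,n$ exactly once. A classical pattern $\tau$ of length $m$ (written with dashes) occurs in $\pi$ at indices $i_1<\dots<i_m$ if $\pi_{i_1}\cdots\pi_{i_m}$ is order-isomorphic to $\tau$; $\pi$ contains $\tau$ exactly $r$ times if there are exactly $r$ such index tuples, and avoids $\tau$ if $r=0$. $1\mbox{ - }3\mbox{ - }2$ is the pattern $132$; $1\mbox{ - }2\mbox{ - }\cdots\mbox{ - }k$ is an increasing subsequence of length $k$. For $n\ge2$: up-down permutations satisfy $\pi_1<\pi_2>\pi_3<\cdots$ with $n$ odd; up-up ones satisfy $\pi_1<\pi_2>\pi_3<\cdots$ with $n$ even; down-up ones satisfy $\pi_1>\pi_2<\pi_3>\cdots$ with $n$ odd; down-down ones satisfy $\pi_1>\pi_2<\pi_3>\cdots$ with $n$ even. For $n=0,1$ these classes are empty. $U_r$ is the Chebyshev polynomial of the second kind, $U_r(\cos\theta)=\sin((r+1)\theta)/\sin\theta$; $U_{ -1}=0$, $U_0=1$, $U_1(t)=2t$, $U_r(t)=2tU_{r-1}(t)-U_{r-2}(t)$. -}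

module Defs where

open import Data.Nat as ℕ using (ℕ; zero; suc; _∸_; _<ᵇ_; _≡ᵇ_)
open import Data.Bool using (Bool; true; false; _∧_; not; if_then_else_)
open import Data.List using (List; []; _∷_; _++_; map; concatMap; length; upTo; foldr)
open import Data.Integer using (+_)
open import Data.Rational as ℚ using (ℚ; 0ℚ; 1ℚ; ½)
open import Relation.Binary.PropositionalEquality using (_≡_)
open import Data.Product using (_×_; _,_; proj₁; proj₂)

_==ᴮ_ : Bool → Bool → Bool
true  ==ᴮ b = b
false ==ᴮ b = not b

count : {A : Set} → (A → Bool) → List A → ℕ
count p []       = 0
count p (a ∷ as) = if p a then suc (count p as) else count p as

words : ℕ → List ℕ → List (List ℕ)
words zero    A = [] ∷ []
words (suc m) A = concatMap (λ a → map (a ∷_) (words m A)) A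

notIn : ℕ → List ℕ → Bool
notIn a []       = true
notIn a (b ∷ bs) = not (a ≡ᵇ b) ∧ notIn a bs

distinct : List ℕ → Bool
distinct []       = true
distinct (a ∷ as) = notIn a as ∧ distinct as

-- permutations of length n: words π₁⋯πₙ over {1,…,n} with distinct letters
-- (hence containing each of 1,…,n exactly once)
perms : ℕ → List (List ℕ)
perms n = Data.List.filterᵇ distinct (words n (map suc (upTo n)))

-- all subsequences of length k (one entry per choice of index set i₁<⋯<iₖ)
choose : ℕ → List ℕ → List (List ℕ)
choose zero    xs       = [] ∷ []
choose (suc k) []       = []
choose (suc k) (x ∷ xs) = map (x ∷_) (choose k xs) ++ choose (suc k) xs

sameOrder : ℕ → ℕ → ℕ → ℕ → Bool
sameOrder a a' b b' = ((a <ᵇ a') ==ᴮ (b <ᵇ b')) ∧ ((a' <ᵇ a) ==ᴮ (b' <ᵇ b))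

orderIso : List ℕ → List ℕ → Bool
orderIso []       []       = true
orderIso (a ∷ as) (b ∷ bs) = go as bs ∧ orderIso as bs
  where
  go : List ℕ → List ℕ → Bool
  go []         []         = true
  go (a' ∷ as') (b' ∷ bs') = sameOrder a a' b b' ∧ go as' bs'
  go _          _          = false
orderIso _        _        = false

occurrences : List ℕ → List ℕ → ℕ
occurrences τ π = count (λ s → orderIso s τ) (choose (length τ) π)

p132 : List ℕ
p132 = 1 ∷ 3 ∷ 2 ∷ []

incPat : ℕ → List ℕ
incPat k = map suc (upTo k)

alt : Bool → List ℕ → Bool
alt up (a ∷ b ∷ rest) = (if up then a <ᵇ b else b <ᵇ a) ∧ alt (not up) (b ∷ rest)
alt up _              = true

isOdd : ℕ → Bool
isOdd zero    = false
isOdd (suc n) = not (isOdd n)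

atLeast2 : ℕ → Bool
atLeast2 n = 1 <ᵇ n

upDown upUp downUp downDown : List ℕ → Bool
upDown   π = atLeast2 (length π) ∧ isOdd (length π)       ∧ alt true  π
upUp     π = atLeast2 (length π) ∧ not (isOdd (length π)) ∧ alt true  π
downUp   π = atLeast2 (length π) ∧ isOdd (length π)       ∧ alt false π
downDown π = atLeast2 (length π) ∧ not (isOdd (length π)) ∧ alt false π

countClass : (List ℕ → Bool) → ℕ → ℕ → ℕ
countClass C k n =
  count (λ π → C π ∧ (occurrences p132 π ≡ᵇ 0) ∧ (occurrences (incPat k) π ≡ᵇ 1))
        (perms n)

ud dd uu du : ℕ → ℕ → ℕ
ud = countClass upDown
dd = countClass downDown
uu = countClass upUp
du = countClass downUp

PS : Set
PS = ℕ → ℚ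

fromℕℚ : ℕ → ℚ
fromℕℚ n = (+ n) ℚ./ 1

sumTo : ℕ → (ℕ → ℚ) → ℚ
sumTo zero    f = f 0
sumTo (suc n) f = sumTo n f ℚ.+ f (suc n)

_+ₚ_ : PS → PS → PS
(f +ₚ g) n = f n ℚ.+ g n

negₚ : PS → PS
negₚ f n = ℚ.- (f n)

_*ₚ_ : PS → PS → PS
(f *ₚ g) n = sumTo n (λ i → f i ℚ.* g (n ∸ i))

shift : ℕ → PS → PS
shift zero    f n       = f n
shift (suc e) f zero    = 0ℚ
shift (suc e) f (suc n) = shift e f n

constₚ : ℚ → PS
constₚ c zero    = c
constₚ c (suc n) = 0ℚ

-- A Laurent series  x^(-exp) · ser
record Laurent : Set where
  constructor _⊘x^_
  field
    ser : PS
    exp : ℕ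
open Laurent public

-- equality of Laurent series: x^(-e)·f = x^(-e')·g  iff  x^e'·f = x^e·g
_≈_ : Laurent → Laurent → Set
(f ⊘x^ e) ≈ (g ⊘x^ e') = ∀ n → shift e' f n ≡ shift e g n

infix 4 _≈_
infixl 6 _⊕_ _⊖_
infixl 7 _⊛_

_⊕_ : Laurent → Laurent → Laurent
(f ⊘x^ e) ⊕ (g ⊘x^ e') = (shift e' f +ₚ shift e g) ⊘x^ (e ℕ.+ e')

⊝_ : Laurent → Laurent
⊝ (f ⊘x^ e) = negₚ f ⊘x^ e

_⊖_ : Laurent → Laurent → Laurent
a ⊖ b = a ⊕ (⊝ b)

_⊛_ : Laurent → Laurent → Laurent
(f ⊘x^ e) ⊛ (g ⊘x^ e') = (f *ₚ g) ⊘x^ (e ℕ.+ e')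

constL : ℚ → Laurent
constL c = constₚ c ⊘x^ 0

zeroL oneL twoL : Laurent
zeroL = constL 0ℚ
oneL  = constL 1ℚ
twoL  = constL (fromℕℚ 2)

xL : Laurent
xL = shift 1 (constₚ 1ℚ) ⊘x^ 0

_^L_ : Laurent → ℕ → Laurent
a ^L zero  = oneL
a ^L suc n = a ⊛ (a ^L n)

halfInvX : Laurent
halfInvX = constₚ ½ ⊘x^ 1

sumL : List Laurent → Laurent
sumL = foldr _⊕_ zeroL

genFun : (ℕ → ℕ) → Laurent
genFun a = (λ n → fromℕℚ (a n)) ⊘x^ 0

-- Chebyshev polynomials of the second kind evaluated at t:
-- chebPair r t = (U_{r-1}(t), U_r(t)), with U_{-1}=0, U_0=1,
-- U_r = 2t U_{r-1} - U_{r-2}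
chebPair : ℕ → Laurent → Laurent × Laurent
chebPair zero    t = zeroL , oneL
chebPair (suc r) t = let (p , q) = chebPair r t in q , (twoL ⊛ t ⊛ q ⊖ p)

U : ℕ → Laurent → Laurent
U r t = proj₂ (chebPair r t)

Uprev : ℕ → Laurent → Laurent
Uprev r t = proj₁ (chebPair r t)

-- "c = a / b" in the field of formal Laurent series:  c · b = a
_≈_/_ : Laurent → Laurent → Laurent → Set
c ≈ a / b = c ⊛ b ≈ a

infix 4 _≈_/_

Uₓ : ℕ → Laurent
Uₓ r = U r halfInvX

Uₓprev : ℕ → Laurent
Uₓprev r = Uprev r halfInvX

{-# OPTIONS --safe #-}

-- Removing the maximum n from a permutation avoiding 1-3-2 leaves π = L n R with every letter
-- of L above every letter of R, so such permutations are binary trees, and an increasing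
-- subsequence of π lies in L, or is one of L followed by n, or lies in R.  Containing 1-2-⋯-k
-- once (k ≥ 2) therefore means that L contains 1-2-⋯-(k-1) once and R avoids 1-2-⋯-k, or that
-- L avoids 1-2-⋯-(k-1) and R contains 1-2-⋯-k once: a word containing 1-2-⋯-k contains
-- 1-2-⋯-(k-1) at least twice.  In an alternating π the maximum is at a peak, which determines
-- the types of L and R.  The resulting recurrences for the generating functions are linear at
-- each k, and the Chebyshev recurrence x U_r + x U_{r-2} = U_{r-1} solves them.

module Submission where

open import Algebra.Bundles using (CommutativeRing)
import Algebra.Properties.Group as GroupProperties
import Algebra.Solver.Ring.NaturalCoefficients.Default as NatSolver
open import Data.List using (List; []; _∷_; _++_; [_]; foldr; map; upTo)
open import Data.List.Properties using (map-++; upTo-∷ʳ)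
open import Data.Nat using (ℕ; zero; suc; _∸_; _<_)
open import Data.Nat.Properties using (+-∸-assoc; n∸n≡0; <⇒≤; ≤-refl; m≤n⇒m≤1+n)
open import Level using (0ℓ; _⊔_)
import Relation.Binary.PropositionalEquality as ≡
import Relation.Binary.Reasoning.Setoid as SetoidReasoning

-- Why (1) and (3) are closed while (2) and (4) are sums: an up-down or up-up permutation has a part
-- of its own type on the right of the maximum, where the forbidden or counted pattern keeps its
-- length, so its series satisfies a linear equation at fixed k that can be solved outright. A
-- down-down permutation has its own type on the left, where the pattern is one letter shorter. Its
-- series therefore satisfies a first-order recurrence in k, and unrolling this leaves one term for
-- each m. Down-up permutations do not recur at all; they are built from a down-down left part and
-- an up-up right part. A quotient in the theorem means an equation after multiplication by the
-- denominator, so every formula is derived in the form series times Chebyshev factor, and no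
-- Chebyshev factor is ever inverted. Equal Laurent series may carry different exponents, so the
-- ring laws hold only up to `_≈_`; hence the algebra is done in an arbitrary commutative ring and
-- applied to Laurent series at the end.

-- Fractions over a commutative ring, compared by cross-multiplication

module Fractions {c ℓ} (R : CommutativeRing c ℓ) where
  open CommutativeRing R
  open SetoidReasoning setoid
  open NatSolver commutativeSemiring using (solve; _:=_; _:+_; _:*_)

  -- In a general ring, transitivity for f/m, g/n, h/p holds only up to the middle denominator,
  -- hence the common factor n. In `≈-trans` this factor is a power of x and gets cancelled.
  frac-trans : ∀ f m g n h p → n * f ≈ m * g → p * g ≈ n * h → n * (p * f) ≈ n * (m * h)
  frac-trans f m g n h p e₁ e₂ = begin
    n * (p * f) ≈⟨ solve 3 (λ n p f → n :* (p :* f) := p :* (n :* f)) refl n p f ⟩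
    p * (n * f) ≈⟨ *-congˡ e₁ ⟩
    p * (m * g) ≈⟨ solve 3 (λ p m g → p :* (m :* g) := m :* (p :* g)) refl p m g ⟩
    m * (p * g) ≈⟨ *-congˡ e₂ ⟩
    m * (n * h) ≈⟨ solve 3 (λ m n h → m :* (n :* h) := n :* (m :* h)) refl m n h ⟩
    n * (m * h) ∎

  frac-+-cong : ∀ f m f′ m′ g n g′ n′ → m′ * f ≈ m * f′ → n′ * g ≈ n * g′ →
                (m′ * n′) * (n * f + m * g) ≈ (m * n) * (n′ * f′ + m′ * g′)
  frac-+-cong f m f′ m′ g n g′ n′ e₁ e₂ = begin
    (m′ * n′) * (n * f + m * g)
      ≈⟨ solve 6 (λ f m m′ g n n′ → (m′ :* n′) :* (n :* f :+ m :* g)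
           := (n :* n′) :* (m′ :* f) :+ (m :* m′) :* (n′ :* g)) refl f m m′ g n n′ ⟩
    (n * n′) * (m′ * f) + (m * m′) * (n′ * g)
      ≈⟨ +-cong (*-congˡ e₁) (*-congˡ e₂) ⟩
    (n * n′) * (m * f′) + (m * m′) * (n * g′)
      ≈⟨ solve 6 (λ m f′ m′ n g′ n′ → (n :* n′) :* (m :* f′) :+ (m :* m′) :* (n :* g′)
           := (m :* n) :* (n′ :* f′ :+ m′ :* g′)) refl m f′ m′ n g′ n′ ⟩
    (m * n) * (n′ * f′ + m′ * g′) ∎

  frac-*-cong : ∀ f m f′ m′ g n g′ n′ → m′ * f ≈ m * f′ → n′ * g ≈ n * g′ →
                (m′ * n′) * (f * g) ≈ (m * n) * (f′ * g′)
  frac-*-cong f m f′ m′ g n g′ n′ e₁ e₂ = begin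
    (m′ * n′) * (f * g)
      ≈⟨ solve 4 (λ a b c d → (a :* b) :* (c :* d) := (a :* c) :* (b :* d)) refl m′ n′ f g ⟩
    (m′ * f) * (n′ * g) ≈⟨ *-cong e₁ e₂ ⟩
    (m * f′) * (n * g′)
      ≈⟨ solve 4 (λ a b c d → (a :* b) :* (c :* d) := (a :* c) :* (b :* d)) refl m f′ n g′ ⟩
    (m * n) * (f′ * g′) ∎

  frac-+-assoc : ∀ f m g n h p →
    (m * (n * p)) * (p * (n * f + m * g) + (m * n) * h) ≈
    ((m * n) * p) * ((n * p) * f + m * (p * g + n * h))
  frac-+-assoc = solve 6 (λ f m g n h p →
    (m :* (n :* p)) :* (p :* (n :* f :+ m :* g) :+ (m :* n) :* h) :=
    ((m :* n) :* p) :* ((n :* p) :* f :+ m :* (p :* g :+ n :* h))) refl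

  frac-*-assoc : ∀ f m g n h p → (m * (n * p)) * ((f * g) * h) ≈ ((m * n) * p) * (f * (g * h))
  frac-*-assoc = solve 6 (λ f m g n h p →
    (m :* (n :* p)) :* ((f :* g) :* h) := ((m :* n) :* p) :* (f :* (g :* h))) refl

  frac-+-comm : ∀ f m g n → (n * m) * (n * f + m * g) ≈ (m * n) * (m * g + n * f)
  frac-+-comm = solve 4 (λ f m g n →
    (n :* m) :* (n :* f :+ m :* g) := (m :* n) :* (m :* g :+ n :* f)) refl

  frac-*-comm : ∀ f m g n → (n * m) * (f * g) ≈ (m * n) * (g * f)
  frac-*-comm = solve 4 (λ f m g n → (n :* m) :* (f :* g) := (m :* n) :* (g :* f)) refl

  frac-*-distribˡ-+ : ∀ f m g n h p →
    ((m * n) * (m * p)) * (f * (p * g + n * h)) ≈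
    (m * (n * p)) * ((m * p) * (f * g) + (m * n) * (f * h))
  frac-*-distribˡ-+ = solve 6 (λ f m g n h p →
    ((m :* n) :* (m :* p)) :* (f :* (p :* g :+ n :* h)) :=
    (m :* (n :* p)) :* ((m :* p) :* (f :* g) :+ (m :* n) :* (f :* h))) refl

  frac-+-identityˡ : ∀ f m → m * (m * 0# + 1# * f) ≈ (1# * m) * f
  frac-+-identityˡ f m = begin
    m * (m * 0# + 1# * f) ≈⟨ *-congˡ (+-cong (zeroʳ m) (*-identityˡ f)) ⟩
    m * (0# + f)          ≈⟨ *-congˡ (+-identityˡ f) ⟩
    m * f                 ≈⟨ *-congʳ (*-identityˡ m) ⟨
    (1# * m) * f          ∎

  frac-*-identityˡ : ∀ f m → m * (1# * f) ≈ (1# * m) * f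
  frac-*-identityˡ f m = trans (*-congˡ (*-identityˡ f)) (sym (*-congʳ (*-identityˡ m)))

  frac-+-inverseˡ : ∀ f m → 1# * (m * (- f) + m * f) ≈ (m * m) * 0#
  frac-+-inverseˡ f m = begin
    1# * (m * (- f) + m * f) ≈⟨ *-identityˡ _ ⟩
    m * (- f) + m * f        ≈⟨ distribˡ m (- f) f ⟨
    m * ((- f) + f)          ≈⟨ *-congˡ (-‿inverseˡ f) ⟩
    m * 0#                   ≈⟨ zeroʳ m ⟩
    0#                       ≈⟨ zeroʳ (m * m) ⟨
    (m * m) * 0#             ∎

  frac-neg-cong : ∀ f m f′ m′ → m′ * f ≈ m * f′ → m′ * (- f) ≈ m * (- f′)
  frac-neg-cong f m f′ m′ e = begin
    m′ * (- f)   ≈⟨ -‿distribʳ-* m′ f ⟨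
    - (m′ * f)   ≈⟨ -‿cong e ⟩
    - (m * f′)   ≈⟨ -‿distribʳ-* m f′ ⟩
    m * (- f′)   ∎
    where open import Algebra.Properties.Ring ring using (-‿distribʳ-*)

-- The index j stands for the pattern 1-2-⋯-(j+1).  Lower-case series count permutations
-- avoiding it, upper-case ones those containing it once: a, A are up-down, b, B up-up,
-- c, C down-down and D down-up.  V j is U_{j-1}(1/2x), and X n is xⁿ.
record Recurrences {r ℓ} (R : CommutativeRing r ℓ) : Set (r ⊔ ℓ) where
  open CommutativeRing R
  field
    x x⁻¹ : Carrier
    a A b B c C D V X : ℕ → Carrier
    inverse : x⁻¹ * x ≈ 1#
    X-zero  : X 0 ≈ 1#
    X-suc   : ∀ n → X (suc n) ≈ x * X n
    V-zero  : V 0 ≈ 0#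
    V-one   : V 1 ≈ 1#
    V-step  : ∀ j → x * V (suc (suc j)) + x * V j ≈ V (suc j)
    a-zero  : a 0 ≈ 0#
    a-step  : ∀ j → a (suc j) ≈ x + x * (a j * a (suc j))
    A-zero  : A 0 ≈ x
    A-step  : ∀ j → A (suc j) ≈ x * (A j * a (suc j) + a j * A (suc j))
    b-step  : ∀ j → b (suc j) ≈ 1# + x * (a j * b (suc j))
    B-step  : ∀ j → B (suc j) ≈ x * (A j * b (suc j) + a j * B (suc j))
    c-zero  : c 0 ≈ 1#
    c-step  : ∀ j → c (suc j) ≈ 1# + x * (c j * a (suc j))
    C-zero  : C 0 ≈ 0#
    C-step  : ∀ j → C (suc j) ≈ x * (C j * a (suc j) + c j * A (suc j))
    D-step  : ∀ j → D (suc j) ≈ x * (C j * b (suc j) + c j * B (suc j))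

-- Solution of the recurrences

module Solution {r ℓ} (R : CommutativeRing r ℓ) (S : Recurrences R) where
  open CommutativeRing R
  open Recurrences S
  open SetoidReasoning setoid
  open NatSolver commutativeSemiring using (solve; _:=_; _:+_; _:*_)
  open GroupProperties +-group using () renaming (∙-cancelʳ to +-cancelʳ)

  *-cancel-x : ∀ {u v} → x * u ≈ x * v → u ≈ v
  *-cancel-x {u} {v} eq = begin
    u               ≈⟨ expand u ⟨
    x⁻¹ * (x * u)   ≈⟨ *-congˡ eq ⟩
    x⁻¹ * (x * v)   ≈⟨ expand v ⟩
    v               ∎
    where
    expand : ∀ w → x⁻¹ * (x * w) ≈ w
    expand w = trans (sym (*-assoc x⁻¹ x w)) (trans (*-congʳ inverse) (*-identityˡ w))

  -- A linear equation z = u + x a_{j} z is solved by expanding z V_{j+1} with V-step.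
  solve-linear : ∀ j z u → a j * V (suc j) ≈ V j → z ≈ u + x * (a j * z) →
                 x * (z * V (suc (suc j))) ≈ u * V (suc j)
  solve-linear j z u aV eq = +-cancelʳ (x * (z * V j)) _ _ (begin
    x * (z * V (suc (suc j))) + x * (z * V j)
      ≈⟨ solve 4 (λ x z v w → x :* (z :* w) :+ x :* (z :* v) := z :* (x :* w :+ x :* v))
           refl x z (V j) (V (suc (suc j))) ⟩
    z * (x * V (suc (suc j)) + x * V j)
      ≈⟨ *-congˡ (V-step j) ⟩
    z * V (suc j)
      ≈⟨ *-congʳ eq ⟩
    (u + x * (a j * z)) * V (suc j)
      ≈⟨ solve 5 (λ u x a z v → (u :+ x :* (a :* z)) :* v := u :* v :+ x :* (z :* (a :* v)))
           refl u x (a j) z (V (suc j)) ⟩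
    u * V (suc j) + x * (z * (a j * V (suc j)))
      ≈⟨ +-congˡ (*-congˡ (*-congˡ aV)) ⟩
    u * V (suc j) + x * (z * V j) ∎)

  -- Read as a_{j+1} = x / (1 - x a_j), `a-step` is a continued fraction, whose values are ratios of
  -- consecutive solutions of the linear recurrence `V-step`.
  a-V : ∀ j → a j * V (suc j) ≈ V j
  a-V zero    = begin
    a 0 * V 1 ≈⟨ *-congʳ a-zero ⟩
    0# * V 1  ≈⟨ zeroˡ (V 1) ⟩
    0#        ≈⟨ V-zero ⟨
    V 0       ∎
  a-V (suc j) = *-cancel-x (solve-linear j (a (suc j)) x (a-V j) (a-step j))

  A-linear : ∀ j → A (suc j) ≈ x * (A j * a (suc j)) + x * (a j * A (suc j))
  A-linear j = trans (A-step j) (distribˡ x _ _)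

  B-linear : ∀ j → B (suc j) ≈ x * (A j * b (suc j)) + x * (a j * B (suc j))
  B-linear j = trans (B-step j) (distribˡ x _ _)

  -- The product on the left does not depend on j. Of the two factors V_{j+2}, one is used up by the
  -- linear equation for A_{j+1} and the other by the a_{j+1} in its inhomogeneous term; each leaves
  -- a V_{j+1} behind.
  A-V : ∀ j → A j * (V (suc j) * V (suc j)) ≈ x
  A-V zero    = begin
    A 0 * (V 1 * V 1) ≈⟨ *-cong A-zero (*-cong V-one V-one) ⟩
    x * (1# * 1#)     ≈⟨ *-congˡ (*-identityˡ 1#) ⟩
    x * 1#            ≈⟨ *-identityʳ x ⟩
    x                 ∎
  A-V (suc j) = *-cancel-x (begin
    x * (A (suc j) * (w * w))
      ≈⟨ solve 3 (λ x A w → x :* (A :* (w :* w)) := (x :* (A :* w)) :* w) refl x (A (suc j)) w ⟩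
    (x * (A (suc j) * w)) * w
      ≈⟨ *-congʳ (solve-linear j (A (suc j)) _ (a-V j) (A-linear j)) ⟩
    ((x * (A j * a (suc j))) * v) * w
      ≈⟨ solve 5 (λ x A a v w → ((x :* (A :* a)) :* v) :* w := x :* ((A :* v) :* (a :* w)))
           refl x (A j) (a (suc j)) v w ⟩
    x * ((A j * v) * (a (suc j) * w))
      ≈⟨ *-congˡ (*-congˡ (a-V (suc j))) ⟩
    x * ((A j * v) * v)
      ≈⟨ *-congˡ (*-assoc (A j) v v) ⟩
    x * (A j * (v * v))
      ≈⟨ *-congˡ (A-V j) ⟩
    x * x ∎)
    where
    v = V (suc j)
    w = V (suc (suc j))

  b-V : ∀ j → x * (b (suc j) * V (suc (suc j))) ≈ V (suc j)
  b-V j = trans (solve-linear j (b (suc j)) 1# (a-V j) (b-step j)) (*-identityˡ _)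

  -- The argument of `A-V` with b in place of a. The x from the linear equation is absorbed by
  -- `b-V`, so the result is smaller by a factor x.
  B-V : ∀ j → B (suc j) * (V (suc (suc j)) * V (suc (suc j))) ≈ 1#
  B-V j = *-cancel-x (begin
    x * (B (suc j) * (w * w))
      ≈⟨ solve 3 (λ x A w → x :* (A :* (w :* w)) := (x :* (A :* w)) :* w) refl x (B (suc j)) w ⟩
    (x * (B (suc j) * w)) * w
      ≈⟨ *-congʳ (solve-linear j (B (suc j)) _ (a-V j) (B-linear j)) ⟩
    ((x * (A j * b (suc j))) * v) * w
      ≈⟨ solve 5 (λ x A b v w → ((x :* (A :* b)) :* v) :* w := (A :* v) :* (x :* (b :* w)))
           refl x (A j) (b (suc j)) v w ⟩
    (A j * v) * (x * (b (suc j) * w))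
      ≈⟨ *-congˡ (b-V j) ⟩
    (A j * v) * v
      ≈⟨ *-assoc (A j) v v ⟩
    A j * (v * v)
      ≈⟨ A-V j ⟩
    x
      ≈⟨ *-identityʳ x ⟨
    x * 1# ∎)
    where
    v = V (suc j)
    w = V (suc (suc j))

  -- b_{j+1} is the inverse of 1 - x a_j, so it turns linear equations into formulas.
  solve-by-b : ∀ j z u → z ≈ u + x * (a j * z) → z ≈ u * b (suc j)
  solve-by-b j z u eq = +-cancelʳ (x * (a j * (z * b′))) _ _ (begin
    z + x * (a j * (z * b′))
      ≈⟨ +-congʳ (*-identityˡ z) ⟨
    1# * z + x * (a j * (z * b′))
      ≈⟨ solve 5 (λ o x a z b → o :* z :+ x :* (a :* (z :* b)) := z :* (o :+ x :* (a :* b)))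
           refl 1# x (a j) z b′ ⟩
    z * (1# + x * (a j * b′))
      ≈⟨ *-congˡ (b-step j) ⟨
    z * b′
      ≈⟨ *-congʳ eq ⟩
    (u + x * (a j * z)) * b′
      ≈⟨ solve 5 (λ u x a z b → (u :+ x :* (a :* z)) :* b := u :* b :+ x :* (a :* (z :* b)))
           refl u x (a j) z b′ ⟩
    u * b′ + x * (a j * (z * b′)) ∎)
    where
    b′ = b (suc j)

  -- Both sides solve the same linear equation. Combinatorially, an up-down permutation avoiding
  -- 1-3-2 ends in its letter 1, which lies in no increasing subsequence of length two or more;
  -- deleting it leaves an up-up permutation or the empty word.
  a≈xb : ∀ j → a (suc j) ≈ x * b (suc j)
  a≈xb j = solve-by-b j (a (suc j)) x (a-step j)

  A≈xB : ∀ j → A (suc j) ≈ x * B (suc j)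
  A≈xB j = begin
    A (suc j)
      ≈⟨ solve-by-b j (A (suc j)) _ (A-linear j) ⟩
    (x * (A j * a (suc j))) * b (suc j)
      ≈⟨ *-congʳ (*-congˡ (*-congˡ (a≈xb j))) ⟩
    (x * (A j * (x * b (suc j)))) * b (suc j)
      ≈⟨ solve 3 (λ x A b → (x :* (A :* (x :* b))) :* b := x :* ((x :* (A :* b)) :* b))
           refl x (A j) (b (suc j)) ⟩
    x * ((x * (A j * b (suc j))) * b (suc j))
      ≈⟨ *-congˡ (solve-by-b j (B (suc j)) _ (B-linear j)) ⟨
    x * B (suc j) ∎

  -- This is the factor 1/x by which (4) differs from (2). Down-down permutations avoiding 1-3-2
  -- also end in the letter 1, and deleting it gives the down-up ones.
  C≈xD : ∀ j → C (suc j) ≈ x * D (suc j)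
  C≈xD j = begin
    C (suc j)
      ≈⟨ C-step j ⟩
    x * (C j * a (suc j) + c j * A (suc j))
      ≈⟨ *-congˡ (+-cong (*-congˡ (a≈xb j)) (*-congˡ (A≈xB j))) ⟩
    x * (C j * (x * b (suc j)) + c j * (x * B (suc j)))
      ≈⟨ solve 5 (λ x C b c B → x :* (C :* (x :* b) :+ c :* (x :* B)) := x :* (x :* (C :* b :+ c :* B)))
           refl x (C j) (b (suc j)) (c j) (B (suc j)) ⟩
    x * (x * (C j * b (suc j) + c j * B (suc j)))
      ≈⟨ *-congˡ (D-step j) ⟨
    x * D (suc j) ∎

  D-V : ∀ j → D (suc j) * (x * V (suc (suc j))) ≈ C (suc j) * V (suc (suc j))
  D-V j = begin
    D (suc j) * (x * w) ≈⟨ solve 3 (λ d x w → d :* (x :* w) := (x :* d) :* w) refl (D (suc j)) x w ⟩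
    (x * D (suc j)) * w ≈⟨ *-congʳ (C≈xD j) ⟨
    C (suc j) * w       ∎
    where
    w = V (suc (suc j))

  -- Since c_{j+1} depends on c_j, there is no equation to solve. Each step multiplies the power of
  -- x by x, while `V-step` carries V_j to V_{j+1}; the power of x is the trace of the initial value
  -- c_0 = 1, the empty word.
  c-V : ∀ j → x * (c j * V (suc j)) ≈ X (suc j) + V j
  c-V zero    = begin
    x * (c 0 * V 1)  ≈⟨ *-congˡ (*-cong c-zero V-one) ⟩
    x * (1# * 1#)    ≈⟨ *-congˡ (*-identityˡ 1#) ⟩
    x * 1#           ≈⟨ *-congˡ X-zero ⟨
    x * X 0          ≈⟨ X-suc 0 ⟨
    X 1              ≈⟨ +-identityʳ (X 1) ⟨
    X 1 + 0#         ≈⟨ +-congˡ V-zero ⟨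
    X 1 + V 0        ∎
  c-V (suc j) = begin
    x * (c (suc j) * w)
      ≈⟨ *-congˡ (*-congʳ (c-step j)) ⟩
    x * ((1# + x * (c j * a (suc j))) * w)
      ≈⟨ solve 5 (λ o x c a w → x :* ((o :+ x :* (c :* a)) :* w) := x :* (o :* w) :+ x :* (x :* (c :* (a :* w))))
           refl 1# x (c j) (a (suc j)) w ⟩
    x * (1# * w) + x * (x * (c j * (a (suc j) * w)))
      ≈⟨ +-cong (*-congˡ (*-identityˡ w)) (*-congˡ (*-congˡ (*-congˡ (a-V (suc j))))) ⟩
    x * w + x * (x * (c j * V (suc j)))
      ≈⟨ +-congˡ (*-congˡ (c-V j)) ⟩
    x * w + x * (X (suc j) + V j)
      ≈⟨ solve 4 (λ x w p v → x :* w :+ x :* (p :+ v) := x :* p :+ (x :* w :+ x :* v))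
           refl x w (X (suc j)) (V j) ⟩
    x * X (suc j) + (x * w + x * V j)
      ≈⟨ +-cong (sym (X-suc (suc j))) (V-step j) ⟩
    X (suc (suc j)) + V (suc j) ∎
    where
    w = V (suc (suc j))

  -- By A-V the factor A_{m+1} V_{m+2} is x / V_{m+2}.
  q : ℕ → ℕ → Carrier
  q j m = X (j ∸ m) * (c m * (A (suc m) * V (suc (suc m))))

  -- Identifies `q j m`, for j = k - 1, with the summand of (2) and (4): V_{m+1} clears the
  -- denominator of c_m, and V_{m+2} completes the square in `A-V`.
  q-V : ∀ j m → q j m * (V (suc m) * V (suc (suc m))) ≈ X (j ∸ m) * (X (suc m) + V m)
  q-V j m = begin
    (X (j ∸ m) * (c m * (A (suc m) * w))) * (v * w)
      ≈⟨ solve 5 (λ p c A v w → (p :* (c :* (A :* w))) :* (v :* w) := p :* ((A :* (w :* w)) :* (c :* v)))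
           refl (X (j ∸ m)) (c m) (A (suc m)) v w ⟩
    X (j ∸ m) * ((A (suc m) * (w * w)) * (c m * v))
      ≈⟨ *-congˡ (*-congʳ (A-V (suc m))) ⟩
    X (j ∸ m) * (x * (c m * v))
      ≈⟨ *-congˡ (c-V m) ⟩
    X (j ∸ m) * (X (suc m) + V m) ∎
    where
    v = V (suc m)
    w = V (suc (suc m))

  -- The last term is split off because passing from j to j + 1 appends the term m = j; `foldr-upTo`
  -- reconciles this with the right fold in the theorem.
  ∑ : ℕ → (ℕ → Carrier) → Carrier
  ∑ zero    f = 0#
  ∑ (suc n) f = ∑ n f + f n

  ∑-scale : ∀ n f g → (∀ m → m < n → g m ≈ x * f m) → ∑ n g ≈ x * ∑ n f
  ∑-scale zero    f g eq = sym (zeroʳ x)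
  ∑-scale (suc n) f g eq =
    trans (+-cong (∑-scale n f g (λ m m<n → eq m (m≤n⇒m≤1+n m<n))) (eq n ≤-refl))
          (sym (distribˡ x _ _))

  foldr-∷ʳ : ∀ (us : List Carrier) v → foldr _+_ 0# (us ++ [ v ]) ≈ foldr _+_ 0# us + v
  foldr-∷ʳ []       v = trans (+-identityʳ v) (sym (+-identityˡ v))
  foldr-∷ʳ (u ∷ us) v = trans (+-congˡ (foldr-∷ʳ us v)) (sym (+-assoc u _ v))

  foldr-upTo : ∀ n f → foldr _+_ 0# (map f (upTo n)) ≈ ∑ n f
  foldr-upTo zero    f = refl
  foldr-upTo (suc n) f = begin
    foldr _+_ 0# (map f (upTo (suc n)))
      ≡⟨ ≡.cong (λ ms → foldr _+_ 0# (map f ms)) (upTo-∷ʳ n) ⟨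
    foldr _+_ 0# (map f (upTo n ++ [ n ]))
      ≡⟨ ≡.cong (foldr _+_ 0#) (map-++ f (upTo n) [ n ]) ⟩
    foldr _+_ 0# (map f (upTo n) ++ [ f n ])
      ≈⟨ foldr-∷ʳ (map f (upTo n)) (f n) ⟩
    foldr _+_ 0# (map f (upTo n)) + f n
      ≈⟨ +-congʳ (foldr-upTo n f) ⟩
    ∑ n f + f n ∎

  q-suc : ∀ j m → m < j → q (suc j) m ≈ x * q j m
  q-suc j m m<j = begin
    X (suc j ∸ m) * s      ≡⟨ ≡.cong (λ e → X e * s) (+-∸-assoc 1 (<⇒≤ m<j)) ⟩
    X (suc (j ∸ m)) * s    ≈⟨ *-congʳ (X-suc (j ∸ m)) ⟩
    (x * X (j ∸ m)) * s    ≈⟨ *-assoc x (X (j ∸ m)) s ⟩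
    x * (X (j ∸ m) * s)    ∎
    where
    s = c m * (A (suc m) * V (suc (suc m)))

  q-last : ∀ j → q (suc j) j ≈ x * (c j * (A (suc j) * V (suc (suc j))))
  q-last j = *-congʳ (begin
    X (suc j ∸ j)   ≡⟨ ≡.cong X (+-∸-assoc 1 (≤-refl {j})) ⟩
    X (suc (j ∸ j)) ≡⟨ ≡.cong (λ e → X (suc e)) (n∸n≡0 j) ⟩
    X 1             ≈⟨ X-suc 0 ⟩
    x * X 0         ≈⟨ *-congˡ X-zero ⟩
    x * 1#          ≈⟨ *-identityʳ x ⟩
    x               ∎)

  -- Multiplying `C-step` by V_{j+2} and using `a-V` turns it into a recurrence in which the
  -- previous value of C_j V_{j+1} is multiplied by x: every old term gains a factor x (`q-suc`),
  -- and the inhomogeneous part is the new last term (`q-last`).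
  C-∑ : ∀ j → C j * V (suc j) ≈ ∑ j (q j)
  C-∑ zero    = trans (*-congʳ C-zero) (zeroˡ (V 1))
  C-∑ (suc j) = begin
    C (suc j) * w
      ≈⟨ *-congʳ (C-step j) ⟩
    (x * (C j * a (suc j) + c j * A (suc j))) * w
      ≈⟨ solve 6 (λ x C a c A w → (x :* (C :* a :+ c :* A)) :* w := x :* (C :* (a :* w)) :+ x :* (c :* (A :* w)))
           refl x (C j) (a (suc j)) (c j) (A (suc j)) w ⟩
    x * (C j * (a (suc j) * w)) + x * (c j * (A (suc j) * w))
      ≈⟨ +-cong (*-congˡ (*-congˡ (a-V (suc j)))) (sym (q-last j)) ⟩
    x * (C j * V (suc j)) + q (suc j) j
      ≈⟨ +-congʳ (*-congˡ (C-∑ j)) ⟩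
    x * ∑ j (q j) + q (suc j) j
      ≈⟨ +-congʳ (∑-scale j (q j) (q (suc j)) (q-suc j)) ⟨
    ∑ j (q (suc j)) + q (suc j) j ∎
    where
    w = V (suc (suc j))

  C-V : ∀ j → C j * V (suc j) ≈ foldr _+_ 0# (map (q j) (upTo j))
  C-V j = trans (C-∑ j) (sym (foldr-upTo j (q j)))

open import Defs
import Algebra.Properties.CommutativeSemigroup as CommutativeSemigroupProperties
open import Algebra.Structures using (IsCommutativeRing)
open import Data.Bool using (Bool; true; false; _∧_; _∨_; not; if_then_else_; _xor_; T)
open import Data.Bool.Properties using (T-∧; T?; ∧-assoc; ∧-identityʳ; ∧-zeroʳ; not-involutive)
open import Data.Empty using (⊥; ⊥-elim)
import Data.Integer as ℤ
import Data.Integer.Properties as ℤₚ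
open import Data.List using (length; applyUpTo; filterᵇ; concatMap; cartesianProductWith)
import Data.List.Properties as Listₚ
open import Data.List.Membership.Propositional using (_∈_)
import Data.List.Membership.Propositional.Properties as ∈ₚ
open import Data.List.Membership.Propositional.Properties.WithK using (unique∧set⇒bag)
open import Data.List.Relation.Binary.BagAndSetEquality using (∼bag⇒↭)
open import Data.List.Relation.Binary.Permutation.Propositional as Perm using (_↭_)
open import Data.List.Relation.Binary.Sublist.Propositional as Sublist using (_⊆_; []; _∷_; _∷ʳ_; ⊆-trans; ⊆-refl)
import Data.List.Relation.Binary.Sublist.Propositional.Properties as Sublistₚ
open import Data.List.Relation.Unary.All as All using (All; []; _∷_)
import Data.List.Relation.Unary.All.Properties as Allₚ
open import Data.List.Relation.Unary.AllPairs as AllPairs using (AllPairs; []; _∷_)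
import Data.List.Relation.Unary.AllPairs.Properties as AllPairsₚ
open import Data.List.Relation.Unary.Any using (here; there)
open import Data.List.Relation.Unary.Unique.Propositional using (Unique)
import Data.List.Relation.Unary.Unique.Propositional.Properties as Uniqueₚ
open import Data.Nat as ℕ using (_+_; _≤_; z≤n; s≤s; _≡ᵇ_; _<ᵇ_)
open import Data.List.Membership.DecPropositional ℕ._≟_ using (_∈?_)
import Data.Nat.Properties as ℕₚ
import Data.Nat.Solver as ℕSolver
open import Data.Product using (_×_; _,_; proj₁; proj₂; Σ; ∃; ∃₂)
open import Data.Rational as ℚ using (ℚ; 0ℚ; 1ℚ; ½)
import Data.Rational.Properties as ℚₚ
import Data.Rational.Solver as ℚSolver
import Data.Rational.Unnormalised as ℚᵘ
import Data.Rational.Unnormalised.Properties as ℚᵘₚ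
open import Data.Sum using (inj₁; inj₂)
open import Function using (_∘_; mk⇔; Equivalence)
open import Relation.Nullary using (¬_; yes; no)
open import Relation.Binary.PropositionalEquality using (_≡_; _≢_; refl; sym; trans; cong; cong₂; subst; module ≡-Reasoning)

-- Formal power series

infix 4 _≐_
_≐_ : PS → PS → Set
f ≐ g = ∀ n → f n ≡ g n

tail : PS → PS
tail f n = f (suc n)

scale : ℚ → PS → PS
scale c f n = c ℚ.* f n

module ℚ+ = CommutativeSemigroupProperties (CommutativeRing.+-commutativeSemigroup ℚₚ.+-*-commutativeRing)
module ℚ* = CommutativeSemigroupProperties (CommutativeRing.*-commutativeSemigroup ℚₚ.+-*-commutativeRing)

sumTo-cong : ∀ n {f g : PS} → (∀ i → i ≤ n → f i ≡ g i) → sumTo n f ≡ sumTo n g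
sumTo-cong zero    f≡g = f≡g 0 z≤n
sumTo-cong (suc n) f≡g =
  cong₂ ℚ._+_ (sumTo-cong n (λ i i≤n → f≡g i (ℕₚ.m≤n⇒m≤1+n i≤n))) (f≡g (suc n) ℕₚ.≤-refl)

sumTo-+ : ∀ n f g → sumTo n (f +ₚ g) ≡ sumTo n f ℚ.+ sumTo n g
sumTo-+ zero    f g = refl
sumTo-+ (suc n) f g =
  trans (cong (ℚ._+ (f (suc n) ℚ.+ g (suc n))) (sumTo-+ n f g))
        (ℚ+.interchange (sumTo n f) (sumTo n g) (f (suc n)) (g (suc n)))

sumTo-head : ∀ n f → sumTo (suc n) f ≡ f 0 ℚ.+ sumTo n (tail f)
sumTo-head zero    f = refl
sumTo-head (suc n) f = trans (cong (ℚ._+ f (suc (suc n))) (sumTo-head n f))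
        (ℚₚ.+-assoc (f 0) (sumTo n (tail f)) (f (suc (suc n))))

-- Peeling off an end term reduces coefficient n + 1 of a product to coefficient n of a product with
-- a tail. The ring laws become inductions on the coefficient, free of reindexed sums.
*ₚ-headˡ : ∀ f g n → (f *ₚ g) (suc n) ≡ f 0 ℚ.* g (suc n) ℚ.+ (tail f *ₚ g) n
*ₚ-headˡ f g n = sumTo-head n (λ i → f i ℚ.* g (suc n ∸ i))

*ₚ-headʳ : ∀ f g n → (f *ₚ g) (suc n) ≡ (f *ₚ tail g) n ℚ.+ f (suc n) ℚ.* g 0
*ₚ-headʳ f g n = cong₂ ℚ._+_
  (sumTo-cong n (λ i i≤n → cong (λ m → f i ℚ.* g m) (ℕₚ.+-∸-assoc 1 i≤n)))
  (cong (λ m → f (suc n) ℚ.* g m) (ℕₚ.n∸n≡0 n))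

*ₚ-cong : ∀ {f f′ g g′} → f ≐ f′ → g ≐ g′ → f *ₚ g ≐ f′ *ₚ g′
*ₚ-cong f≐ g≐ n = sumTo-cong n (λ i _ → cong₂ ℚ._*_ (f≐ i) (g≐ (n ∸ i)))

*ₚ-comm : ∀ f g → f *ₚ g ≐ g *ₚ f
*ₚ-comm f g zero    = ℚₚ.*-comm (f 0) (g 0)
*ₚ-comm f g (suc n) = begin
  (f *ₚ g) (suc n)                          ≡⟨ *ₚ-headˡ f g n ⟩
  f 0 ℚ.* g (suc n) ℚ.+ (tail f *ₚ g) n     ≡⟨ ℚₚ.+-comm (f 0 ℚ.* g (suc n)) ((tail f *ₚ g) n) ⟩
  (tail f *ₚ g) n ℚ.+ f 0 ℚ.* g (suc n)     ≡⟨ cong₂ ℚ._+_ (*ₚ-comm (tail f) g n) (ℚₚ.*-comm (f 0) (g (suc n))) ⟩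
  (g *ₚ tail f) n ℚ.+ g (suc n) ℚ.* f 0     ≡⟨ sym (*ₚ-headʳ g f n) ⟩
  (g *ₚ f) (suc n)                          ∎
  where open ≡-Reasoning

*ₚ-distribʳ-+ₚ : ∀ h f g → (f +ₚ g) *ₚ h ≐ (f *ₚ h) +ₚ (g *ₚ h)
*ₚ-distribʳ-+ₚ h f g n =
  trans (sumTo-cong n (λ i _ → ℚₚ.*-distribʳ-+ (h (n ∸ i)) (f i) (g i)))
        (sumTo-+ n (λ i → f i ℚ.* h (n ∸ i)) (λ i → g i ℚ.* h (n ∸ i)))

*ₚ-distribˡ-+ₚ : ∀ h f g → h *ₚ (f +ₚ g) ≐ (h *ₚ f) +ₚ (h *ₚ g)
*ₚ-distribˡ-+ₚ h f g n =
  trans (*ₚ-comm h (f +ₚ g) n)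
        (trans (*ₚ-distribʳ-+ₚ h f g n) (cong₂ ℚ._+_ (*ₚ-comm f h n) (*ₚ-comm g h n)))

scale-*ₚ : ∀ c f g → scale c f *ₚ g ≐ scale c (f *ₚ g)
scale-*ₚ c f g zero    = ℚₚ.*-assoc c (f 0) (g 0)
scale-*ₚ c f g (suc n) =
  trans (*ₚ-headˡ (scale c f) g n)
  (trans (cong₂ ℚ._+_ (ℚₚ.*-assoc c (f 0) (g (suc n))) (scale-*ₚ c (tail f) g n))
  (trans (sym (ℚₚ.*-distribˡ-+ c _ _))
         (cong (c ℚ.*_) (sym (*ₚ-headˡ f g n)))))

-- Induction on the coefficient for all f at once: the tail of f g is f 0 times the tail of g plus
-- the tail of f times g, so only the triple with f replaced by its tail remains.
*ₚ-assoc : ∀ f g h → (f *ₚ g) *ₚ h ≐ f *ₚ (g *ₚ h)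
*ₚ-assoc f g h zero    = ℚₚ.*-assoc (f 0) (g 0) (h 0)
*ₚ-assoc f g h (suc n) = begin
  ((f *ₚ g) *ₚ h) (suc n)
    ≡⟨ *ₚ-headˡ (f *ₚ g) h n ⟩
  f 0 ℚ.* g 0 ℚ.* h (suc n) ℚ.+ (tail (f *ₚ g) *ₚ h) n
    ≡⟨ cong₂ ℚ._+_ (ℚₚ.*-assoc (f 0) (g 0) (h (suc n))) tail-step ⟩
  f 0 ℚ.* (g 0 ℚ.* h (suc n)) ℚ.+ (f 0 ℚ.* (tail g *ₚ h) n ℚ.+ (tail f *ₚ (g *ₚ h)) n)
    ≡⟨ sym (ℚₚ.+-assoc (f 0 ℚ.* (g 0 ℚ.* h (suc n))) (f 0 ℚ.* (tail g *ₚ h) n) ((tail f *ₚ (g *ₚ h)) n)) ⟩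
  f 0 ℚ.* (g 0 ℚ.* h (suc n)) ℚ.+ f 0 ℚ.* (tail g *ₚ h) n ℚ.+ (tail f *ₚ (g *ₚ h)) n
    ≡⟨ cong (ℚ._+ (tail f *ₚ (g *ₚ h)) n) (sym (ℚₚ.*-distribˡ-+ (f 0) (g 0 ℚ.* h (suc n)) ((tail g *ₚ h) n))) ⟩
  f 0 ℚ.* (g 0 ℚ.* h (suc n) ℚ.+ (tail g *ₚ h) n) ℚ.+ (tail f *ₚ (g *ₚ h)) n
    ≡⟨ cong (λ z → f 0 ℚ.* z ℚ.+ (tail f *ₚ (g *ₚ h)) n) (sym (*ₚ-headˡ g h n)) ⟩
  f 0 ℚ.* (g *ₚ h) (suc n) ℚ.+ (tail f *ₚ (g *ₚ h)) n
    ≡⟨ sym (*ₚ-headˡ f (g *ₚ h) n) ⟩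
  (f *ₚ (g *ₚ h)) (suc n) ∎
  where
  open ≡-Reasoning
  tail-step : (tail (f *ₚ g) *ₚ h) n ≡ f 0 ℚ.* (tail g *ₚ h) n ℚ.+ (tail f *ₚ (g *ₚ h)) n
  tail-step = begin
    (tail (f *ₚ g) *ₚ h) n
      ≡⟨ *ₚ-cong {g = h} (*ₚ-headˡ f g) (λ _ → refl) n ⟩
    ((scale (f 0) (tail g) +ₚ (tail f *ₚ g)) *ₚ h) n
      ≡⟨ *ₚ-distribʳ-+ₚ h (scale (f 0) (tail g)) (tail f *ₚ g) n ⟩
    (scale (f 0) (tail g) *ₚ h) n ℚ.+ ((tail f *ₚ g) *ₚ h) n
      ≡⟨ cong₂ ℚ._+_ (scale-*ₚ (f 0) (tail g) h n) (*ₚ-assoc (tail f) g h n) ⟩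
    f 0 ℚ.* (tail g *ₚ h) n ℚ.+ (tail f *ₚ (g *ₚ h)) n ∎

0ₚ-*ₚ : ∀ f g → f ≐ (λ _ → 0ℚ) → f *ₚ g ≐ (λ _ → 0ℚ)
0ₚ-*ₚ f g f≐0 zero    = trans (cong (ℚ._* g 0) (f≐0 0)) (ℚₚ.*-zeroˡ (g 0))
0ₚ-*ₚ f g f≐0 (suc n) =
  trans (*ₚ-headˡ f g n)
        (cong₂ ℚ._+_ (trans (cong (ℚ._* g (suc n)) (f≐0 0)) (ℚₚ.*-zeroˡ (g (suc n))))
                     (0ₚ-*ₚ (tail f) g (λ i → f≐0 (suc i)) n))

constₚ-*ₚ : ∀ c f → constₚ c *ₚ f ≐ scale c f
constₚ-*ₚ c f zero    = refl
constₚ-*ₚ c f (suc n) =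
  trans (*ₚ-headˡ (constₚ c) f n)
  (trans (cong (c ℚ.* f (suc n) ℚ.+_) (0ₚ-*ₚ (tail (constₚ c)) f (λ _ → refl) n))
         (ℚₚ.+-identityʳ _))

*ₚ-identityˡ : ∀ f → constₚ 1ℚ *ₚ f ≐ f
*ₚ-identityˡ f n = trans (constₚ-*ₚ 1ℚ f n) (ℚₚ.*-identityˡ (f n))

constₚ0≐0 : constₚ 0ℚ ≐ (λ _ → 0ℚ)
constₚ0≐0 zero    = refl
constₚ0≐0 (suc n) = refl

PS-isCommutativeRing : IsCommutativeRing _≐_ _+ₚ_ _*ₚ_ negₚ (constₚ 0ℚ) (constₚ 1ℚ)
PS-isCommutativeRing = record
  { isRing = record
    { +-isAbelianGroup = record
      { isGroup = record
        { isMonoid = record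
          { isSemigroup = record
            { isMagma = record
              { isEquivalence = record
                { refl = λ _ → refl
                ; sym = λ p n → sym (p n)
                ; trans = λ p q n → trans (p n) (q n) }
              ; ∙-cong = λ p q n → cong₂ ℚ._+_ (p n) (q n) }
            ; assoc = λ f g h n → ℚₚ.+-assoc (f n) (g n) (h n) }
          ; identity = (λ f n → trans (cong (ℚ._+ f n) (constₚ0≐0 n)) (ℚₚ.+-identityˡ (f n)))
                     , (λ f n → trans (cong (f n ℚ.+_) (constₚ0≐0 n)) (ℚₚ.+-identityʳ (f n))) }
        ; inverse = (λ f n → trans (ℚₚ.+-inverseˡ (f n)) (sym (constₚ0≐0 n)))
                  , (λ f n → trans (ℚₚ.+-inverseʳ (f n)) (sym (constₚ0≐0 n)))
        ; ⁻¹-cong = λ p n → cong ℚ.-_ (p n) }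
      ; comm = λ f g n → ℚₚ.+-comm (f n) (g n) }
    ; *-cong = *ₚ-cong
    ; *-assoc = *ₚ-assoc
    ; *-identity = *ₚ-identityˡ , λ f n → trans (*ₚ-comm f (constₚ 1ℚ) n) (*ₚ-identityˡ f n)
    ; distrib = *ₚ-distribˡ-+ₚ , *ₚ-distribʳ-+ₚ }
  ; *-comm = *ₚ-comm }

PS-commutativeRing : CommutativeRing 0ℓ 0ℓ
PS-commutativeRing = record { isCommutativeRing = PS-isCommutativeRing }

mono : ℕ → PS
mono e = shift e (constₚ 1ℚ)

shift-cong : ∀ e {f g} → f ≐ g → shift e f ≐ shift e g
shift-cong zero    f≐g n       = f≐g n
shift-cong (suc e) f≐g zero    = refl
shift-cong (suc e) f≐g (suc n) = shift-cong e f≐g n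

shift-injective : ∀ e {f g} → shift e f ≐ shift e g → f ≐ g
shift-injective zero    eq n = eq n
shift-injective (suc e) eq n = shift-injective e (λ i → eq (suc i)) n

shift-+ : ∀ a b f → shift (a + b) f ≐ shift a (shift b f)
shift-+ zero    b f n       = refl
shift-+ (suc a) b f zero    = refl
shift-+ (suc a) b f (suc n) = shift-+ a b f n

-- Turns the shifts in the definition of Laurent operations and equality into ring multiplication,
-- so that the identities for fractions apply.
shift-mono : ∀ e f → shift e f ≐ mono e *ₚ f
shift-mono zero    f n       = sym (*ₚ-identityˡ f n)
shift-mono (suc e) f zero    = sym (ℚₚ.*-zeroˡ (f 0))
shift-mono (suc e) f (suc n) = sym (begin
  (mono (suc e) *ₚ f) (suc n)                 ≡⟨ *ₚ-headˡ (mono (suc e)) f n ⟩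
  0ℚ ℚ.* f (suc n) ℚ.+ (mono e *ₚ f) n        ≡⟨ cong (ℚ._+ (mono e *ₚ f) n) (ℚₚ.*-zeroˡ (f (suc n))) ⟩
  0ℚ ℚ.+ (mono e *ₚ f) n                      ≡⟨ ℚₚ.+-identityˡ _ ⟩
  (mono e *ₚ f) n                             ≡⟨ sym (shift-mono e f n) ⟩
  shift e f n                                 ∎)
  where open ≡-Reasoning

mono-+ : ∀ a b → mono (a + b) ≐ mono a *ₚ mono b
mono-+ a b n = trans (shift-+ a b (constₚ 1ℚ) n) (shift-mono a (mono b) n)

-- Powers of x are not zero divisors; the transitivity of `_≈_` rests on this.
mono-cancelˡ : ∀ e {f g} → mono e *ₚ f ≐ mono e *ₚ g → f ≐ g
mono-cancelˡ e {f} {g} eq =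
  shift-injective e (λ n → trans (shift-mono e f n) (trans (eq n) (sym (shift-mono e g n))))

-- Laurent series as a localisation of power series

open Fractions PS-commutativeRing

-- Rep a f m says that a is the fraction f / m, the denominator being a power of x.
record Rep (a : Laurent) (f m : PS) : Set where
  constructor rep
  field
    ser≐ : ser a ≐ f
    exp≐ : mono (exp a) ≐ m

rep-self : ∀ a → Rep a (ser a) (mono (exp a))
rep-self a = rep (λ _ → refl) (λ _ → refl)

rep-const : ∀ c → Rep (constL c) (constₚ c) (constₚ 1ℚ)
rep-const c = rep (λ _ → refl) (λ _ → refl)

rep-⊕ : ∀ {a b f m g n} → Rep a f m → Rep b g n → Rep (a ⊕ b) ((n *ₚ f) +ₚ (m *ₚ g)) (m *ₚ n)
rep-⊕ {a} {b} {f} {m} {g} {n} (rep a≐ m≐) (rep b≐ n≐) = rep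
  (λ i → cong₂ ℚ._+_
    (trans (shift-mono (exp b) (ser a) i) (*ₚ-cong {mono (exp b)} {n} {ser a} {f} n≐ a≐ i))
    (trans (shift-mono (exp a) (ser b) i) (*ₚ-cong {mono (exp a)} {m} {ser b} {g} m≐ b≐ i)))
  (λ i → trans (mono-+ (exp a) (exp b) i) (*ₚ-cong {mono (exp a)} {m} {mono (exp b)} {n} m≐ n≐ i))

rep-⊛ : ∀ {a b f m g n} → Rep a f m → Rep b g n → Rep (a ⊛ b) (f *ₚ g) (m *ₚ n)
rep-⊛ {a} {b} {f} {m} {g} {n} (rep a≐ m≐) (rep b≐ n≐) = rep
  (*ₚ-cong {ser a} {f} {ser b} {g} a≐ b≐)
  (λ i → trans (mono-+ (exp a) (exp b) i) (*ₚ-cong {mono (exp a)} {m} {mono (exp b)} {n} m≐ n≐ i))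

rep-⊝ : ∀ {a f m} → Rep a f m → Rep (⊝ a) (negₚ f) m
rep-⊝ (rep a≐ m≐) = rep (λ i → cong ℚ.-_ (a≐ i)) m≐

≈-intro : ∀ {a b f m g n} → Rep a f m → Rep b g n → n *ₚ f ≐ m *ₚ g → a ≈ b
≈-intro {a} {b} {f} {m} {g} {n} (rep a≐ m≐) (rep b≐ n≐) eq i = begin
  shift (exp b) (ser a) i        ≡⟨ shift-mono (exp b) (ser a) i ⟩
  (mono (exp b) *ₚ ser a) i      ≡⟨ *ₚ-cong {mono (exp b)} {n} {ser a} {f} n≐ a≐ i ⟩
  (n *ₚ f) i                     ≡⟨ eq i ⟩
  (m *ₚ g) i                     ≡⟨ *ₚ-cong {mono (exp a)} {m} {ser b} {g} m≐ b≐ i ⟨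
  (mono (exp a) *ₚ ser b) i      ≡⟨ shift-mono (exp a) (ser b) i ⟨
  shift (exp a) (ser b) i        ∎
  where open ≡-Reasoning

≈-elim : ∀ a b → a ≈ b → mono (exp b) *ₚ ser a ≐ mono (exp a) *ₚ ser b
≈-elim a b a≈b i =
  trans (sym (shift-mono (exp b) (ser a) i)) (trans (a≈b i) (shift-mono (exp a) (ser b) i))

≈-trans : ∀ a b c → a ≈ b → b ≈ c → a ≈ c
≈-trans a b c a≈b b≈c = ≈-intro (rep-self a) (rep-self c)
  (mono-cancelˡ (exp b)
    (frac-trans (ser a) (mono (exp a)) (ser b) (mono (exp b)) (ser c) (mono (exp c))
      (≈-elim a b a≈b) (≈-elim b c b≈c)))

⊕-cong : ∀ a a′ b b′ → a ≈ a′ → b ≈ b′ → a ⊕ b ≈ a′ ⊕ b′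
⊕-cong a a′ b b′ p q = ≈-intro (rep-⊕ (rep-self a) (rep-self b)) (rep-⊕ (rep-self a′) (rep-self b′))
  (frac-+-cong (ser a) (mono (exp a)) (ser a′) (mono (exp a′)) (ser b) (mono (exp b)) (ser b′) (mono (exp b′))
    (≈-elim a a′ p) (≈-elim b b′ q))

⊛-cong : ∀ a a′ b b′ → a ≈ a′ → b ≈ b′ → a ⊛ b ≈ a′ ⊛ b′
⊛-cong a a′ b b′ p q = ≈-intro (rep-⊛ (rep-self a) (rep-self b)) (rep-⊛ (rep-self a′) (rep-self b′))
  (frac-*-cong (ser a) (mono (exp a)) (ser a′) (mono (exp a′)) (ser b) (mono (exp b)) (ser b′) (mono (exp b′))
    (≈-elim a a′ p) (≈-elim b b′ q))

⊝-cong : ∀ a a′ → a ≈ a′ → ⊝ a ≈ ⊝ a′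
⊝-cong a a′ p = ≈-intro (rep-⊝ (rep-self a)) (rep-⊝ (rep-self a′))
  (frac-neg-cong (ser a) (mono (exp a)) (ser a′) (mono (exp a′)) (≈-elim a a′ p))

⊕-assoc : ∀ a b c → (a ⊕ b) ⊕ c ≈ a ⊕ (b ⊕ c)
⊕-assoc a b c =
  ≈-intro (rep-⊕ (rep-⊕ (rep-self a) (rep-self b)) (rep-self c))
          (rep-⊕ (rep-self a) (rep-⊕ (rep-self b) (rep-self c)))
          (frac-+-assoc (ser a) (mono (exp a)) (ser b) (mono (exp b)) (ser c) (mono (exp c)))

⊛-assoc : ∀ a b c → (a ⊛ b) ⊛ c ≈ a ⊛ (b ⊛ c)
⊛-assoc a b c =
  ≈-intro (rep-⊛ (rep-⊛ (rep-self a) (rep-self b)) (rep-self c))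
          (rep-⊛ (rep-self a) (rep-⊛ (rep-self b) (rep-self c)))
          (frac-*-assoc (ser a) (mono (exp a)) (ser b) (mono (exp b)) (ser c) (mono (exp c)))

⊕-comm : ∀ a b → a ⊕ b ≈ b ⊕ a
⊕-comm a b = ≈-intro (rep-⊕ (rep-self a) (rep-self b)) (rep-⊕ (rep-self b) (rep-self a))
  (frac-+-comm (ser a) (mono (exp a)) (ser b) (mono (exp b)))

⊛-comm : ∀ a b → a ⊛ b ≈ b ⊛ a
⊛-comm a b = ≈-intro (rep-⊛ (rep-self a) (rep-self b)) (rep-⊛ (rep-self b) (rep-self a))
  (frac-*-comm (ser a) (mono (exp a)) (ser b) (mono (exp b)))

⊕-identityˡ : ∀ a → zeroL ⊕ a ≈ a
⊕-identityˡ a = ≈-intro (rep-⊕ (rep-const 0ℚ) (rep-self a)) (rep-self a)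
  (frac-+-identityˡ (ser a) (mono (exp a)))

⊛-identityˡ : ∀ a → oneL ⊛ a ≈ a
⊛-identityˡ a = ≈-intro (rep-⊛ (rep-const 1ℚ) (rep-self a)) (rep-self a)
  (frac-*-identityˡ (ser a) (mono (exp a)))

⊝-inverseˡ : ∀ a → (⊝ a) ⊕ a ≈ zeroL
⊝-inverseˡ a = ≈-intro (rep-⊕ (rep-⊝ (rep-self a)) (rep-self a)) (rep-const 0ℚ)
  (frac-+-inverseˡ (ser a) (mono (exp a)))

⊛-distribˡ-⊕ : ∀ a b c → a ⊛ (b ⊕ c) ≈ (a ⊛ b) ⊕ (a ⊛ c)
⊛-distribˡ-⊕ a b c =
  ≈-intro (rep-⊛ (rep-self a) (rep-⊕ (rep-self b) (rep-self c)))
          (rep-⊕ (rep-⊛ (rep-self a) (rep-self b)) (rep-⊛ (rep-self a) (rep-self c)))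
          (frac-*-distribˡ-+ (ser a) (mono (exp a)) (ser b) (mono (exp b)) (ser c) (mono (exp c)))

Laurent-isCommutativeRing : IsCommutativeRing _≈_ _⊕_ _⊛_ ⊝_ zeroL oneL
Laurent-isCommutativeRing = record
  { isRing = record
    { +-isAbelianGroup = record
      { isGroup = record
        { isMonoid = record
          { isSemigroup = record
            { isMagma = record
              { isEquivalence = record
                { refl = λ _ → refl
                ; sym = λ p n → sym (p n)
                ; trans = λ {a} {b} {c} → ≈-trans a b c }
              ; ∙-cong = λ {a} {a′} {b} {b′} → ⊕-cong a a′ b b′ }
            ; assoc = ⊕-assoc }
          ; identity = ⊕-identityˡ
                     , λ a → ≈-trans (a ⊕ zeroL) (zeroL ⊕ a) a (⊕-comm a zeroL) (⊕-identityˡ a) }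
        ; inverse = ⊝-inverseˡ
                  , λ a → ≈-trans (a ⊕ (⊝ a)) ((⊝ a) ⊕ a) zeroL (⊕-comm a (⊝ a)) (⊝-inverseˡ a)
        ; ⁻¹-cong = λ {a} {a′} → ⊝-cong a a′ }
      ; comm = ⊕-comm }
    ; *-cong = λ {a} {a′} {b} {b′} → ⊛-cong a a′ b b′
    ; *-assoc = ⊛-assoc
    ; *-identity = ⊛-identityˡ
                 , λ a → ≈-trans (a ⊛ oneL) (oneL ⊛ a) a (⊛-comm a oneL) (⊛-identityˡ a)
    ; distrib = ⊛-distribˡ-⊕
              , λ a b c → ≈-trans ((b ⊕ c) ⊛ a) (a ⊛ (b ⊕ c)) ((b ⊛ a) ⊕ (c ⊛ a))
                  (⊛-comm (b ⊕ c) a)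
                  (≈-trans (a ⊛ (b ⊕ c)) ((a ⊛ b) ⊕ (a ⊛ c)) ((b ⊛ a) ⊕ (c ⊛ a))
                    (⊛-distribˡ-⊕ a b c)
                    (⊕-cong (a ⊛ b) (b ⊛ a) (a ⊛ c) (c ⊛ a) (⊛-comm a b) (⊛-comm a c))) }
  ; *-comm = ⊛-comm }

Laurent-commutativeRing : CommutativeRing 0ℓ 0ℓ
Laurent-commutativeRing = record { isCommutativeRing = Laurent-isCommutativeRing }

-- Binary trees and their enumeration by size

data Tree : Set where
  leaf : Tree
  node : Tree → Tree → Tree

size : Tree → ℕ
size leaf       = 0
size (node l r) = suc (size l + size r)

concatTo : {A : Set} → ℕ → (ℕ → List A) → List A
concatTo zero    F = F 0
concatTo (suc n) F = concatTo n F ++ F (suc n)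

concatTo-cong : ∀ {A : Set} n {F G : ℕ → List A} → (∀ i → i ≤ n → F i ≡ G i) → concatTo n F ≡ concatTo n G
concatTo-cong zero    eq = eq 0 z≤n
concatTo-cong (suc n) eq =
  cong₂ _++_ (concatTo-cong n (λ i i≤n → eq i (ℕₚ.m≤n⇒m≤1+n i≤n))) (eq (suc n) ℕₚ.≤-refl)

-- The first argument is fuel: the list is complete as soon as it is at least the size.
treesUpTo : ℕ → ℕ → List Tree
treesUpTo N       zero    = [ leaf ]
treesUpTo zero    (suc n) = []
treesUpTo (suc N) (suc n) = concatTo n (λ i → cartesianProductWith node (treesUpTo N i) (treesUpTo N (n ∸ i)))

trees : ℕ → List Tree
trees n = treesUpTo n n

treesUpTo-irrelevant : ∀ {M N} n → n ≤ M → n ≤ N → treesUpTo M n ≡ treesUpTo N n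
treesUpTo-irrelevant zero    _         _         = refl
treesUpTo-irrelevant (suc n) (s≤s n≤M) (s≤s n≤N) = concatTo-cong n (λ i i≤n →
  cong₂ (cartesianProductWith node)
    (treesUpTo-irrelevant i (ℕₚ.≤-trans i≤n n≤M) (ℕₚ.≤-trans i≤n n≤N))
    (treesUpTo-irrelevant (n ∸ i) (ℕₚ.≤-trans (ℕₚ.m∸n≤m n i) n≤M) (ℕₚ.≤-trans (ℕₚ.m∸n≤m n i) n≤N)))

trees-suc : ∀ n → trees (suc n) ≡ concatTo n (λ i → cartesianProductWith node (trees i) (trees (n ∸ i)))
trees-suc n = concatTo-cong n (λ i i≤n →
  cong₂ (cartesianProductWith node)
    (treesUpTo-irrelevant i i≤n ℕₚ.≤-refl)
    (treesUpTo-irrelevant (n ∸ i) (ℕₚ.m∸n≤m n i) ℕₚ.≤-refl))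

-- Weighted generating functions of trees

sumOver : {A : Set} → (A → ℚ) → List A → ℚ
sumOver f []       = 0ℚ
sumOver f (x ∷ xs) = f x ℚ.+ sumOver f xs

module _ {A : Set} where

  sumOver-cong : ∀ {f g : A → ℚ} → (∀ x → f x ≡ g x) → ∀ xs → sumOver f xs ≡ sumOver g xs
  sumOver-cong eq []       = refl
  sumOver-cong eq (x ∷ xs) = cong₂ ℚ._+_ (eq x) (sumOver-cong eq xs)

  sumOver-++ : ∀ (f : A → ℚ) xs ys → sumOver f (xs ++ ys) ≡ sumOver f xs ℚ.+ sumOver f ys
  sumOver-++ f []       ys = sym (ℚₚ.+-identityˡ (sumOver f ys))
  sumOver-++ f (x ∷ xs) ys = trans (cong (f x ℚ.+_) (sumOver-++ f xs ys))
                                   (sym (ℚₚ.+-assoc (f x) (sumOver f xs) (sumOver f ys)))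

  sumOver-concatTo : ∀ (f : A → ℚ) n F → sumOver f (concatTo n F) ≡ sumTo n (λ i → sumOver f (F i))
  sumOver-concatTo f zero    F = refl
  sumOver-concatTo f (suc n) F =
    trans (sumOver-++ f (concatTo n F) (F (suc n)))
          (cong (ℚ._+ sumOver f (F (suc n))) (sumOver-concatTo f n F))

  sumOver-+ : ∀ (f g : A → ℚ) xs → sumOver (λ x → f x ℚ.+ g x) xs ≡ sumOver f xs ℚ.+ sumOver g xs
  sumOver-+ f g []       = refl
  sumOver-+ f g (x ∷ xs) =
    trans (cong (f x ℚ.+ g x ℚ.+_) (sumOver-+ f g xs))
          (ℚ+.interchange (f x) (g x) (sumOver f xs) (sumOver g xs))

  sumOver-0 : ∀ (xs : List A) → sumOver (λ _ → 0ℚ) xs ≡ 0ℚ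
  sumOver-0 []       = refl
  sumOver-0 (x ∷ xs) = trans (ℚₚ.+-identityˡ _) (sumOver-0 xs)

-- The weight whose generating function is x times the product of those of `g` and `h` (`gf-⊠`): x
-- accounts for the root, and the value at `leaf` for the missing constant term.
_⊠_ : (Tree → ℚ) → (Tree → ℚ) → Tree → ℚ
(g ⊠ h) leaf       = 0ℚ
(g ⊠ h) (node l r) = g l ℚ.* h r

sumOver-⊠-map : ∀ g h l rs → sumOver (g ⊠ h) (map (node l) rs) ≡ g l ℚ.* sumOver h rs
sumOver-⊠-map g h l []       = sym (ℚₚ.*-zeroʳ (g l))
sumOver-⊠-map g h l (r ∷ rs) = trans (cong (g l ℚ.* h r ℚ.+_) (sumOver-⊠-map g h l rs))
                                     (sym (ℚₚ.*-distribˡ-+ (g l) (h r) (sumOver h rs)))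

sumOver-⊠ : ∀ g h ls rs → sumOver (g ⊠ h) (cartesianProductWith node ls rs) ≡ sumOver g ls ℚ.* sumOver h rs
sumOver-⊠ g h []       rs = sym (ℚₚ.*-zeroˡ (sumOver h rs))
sumOver-⊠ g h (l ∷ ls) rs =
  trans (sumOver-++ (g ⊠ h) (map (node l) rs) (cartesianProductWith node ls rs))
  (trans (cong₂ ℚ._+_ (sumOver-⊠-map g h l rs) (sumOver-⊠ g h ls rs))
         (sym (ℚₚ.*-distribʳ-+ (sumOver h rs) (g l) (sumOver g ls))))

gf : (Tree → ℚ) → PS
gf f n = sumOver f (trees n)

gf-⊠ : ∀ g h → gf (g ⊠ h) ≐ shift 1 (gf g *ₚ gf h)
gf-⊠ g h zero    = refl
gf-⊠ g h (suc n) = begin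
  sumOver (g ⊠ h) (trees (suc n))
    ≡⟨ cong (sumOver (g ⊠ h)) (trees-suc n) ⟩
  sumOver (g ⊠ h) (concatTo n (λ i → cartesianProductWith node (trees i) (trees (n ∸ i))))
    ≡⟨ sumOver-concatTo (g ⊠ h) n _ ⟩
  sumTo n (λ i → sumOver (g ⊠ h) (cartesianProductWith node (trees i) (trees (n ∸ i))))
    ≡⟨ sumTo-cong n (λ i _ → sumOver-⊠ g h (trees i) (trees (n ∸ i))) ⟩
  (gf g *ₚ gf h) n ∎
  where open ≡-Reasoning

indicator : Bool → ℚ
indicator true  = 1ℚ
indicator false = 0ℚ

isLeaf : Tree → Bool
isLeaf leaf       = true
isLeaf (node _ _) = false

leafᵂ : Tree → ℚ
leafᵂ t = indicator (isLeaf t)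

gf-leaf : gf leafᵂ ≐ constₚ 1ℚ
gf-leaf zero    = refl
gf-leaf (suc n) = begin
  sumOver leafᵂ (trees (suc n))
    ≡⟨ cong (sumOver leafᵂ) (trees-suc n) ⟩
  sumOver leafᵂ (concatTo n F)
    ≡⟨ sumOver-concatTo leafᵂ n F ⟩
  sumTo n (λ i → sumOver leafᵂ (F i))
    ≡⟨ sumTo-cong n (λ i _ → products (trees i) (trees (n ∸ i))) ⟩
  sumTo n (λ _ → 0ℚ)
    ≡⟨ zeros n ⟩
  0ℚ ∎
  where
  open ≡-Reasoning
  F : ℕ → List Tree
  F i = cartesianProductWith node (trees i) (trees (n ∸ i))
  zeros : ∀ m → sumTo m (λ _ → 0ℚ) ≡ 0ℚ
  zeros zero    = refl
  zeros (suc m) = trans (cong (ℚ._+ 0ℚ) (zeros m)) (ℚₚ.+-identityʳ 0ℚ)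
  maps : ∀ l rs → sumOver leafᵂ (map (node l) rs) ≡ 0ℚ
  maps l []       = refl
  maps l (r ∷ rs) = trans (ℚₚ.+-identityˡ _) (maps l rs)
  products : ∀ ls rs → sumOver leafᵂ (cartesianProductWith node ls rs) ≡ 0ℚ
  products []       rs = refl
  products (l ∷ ls) rs =
    trans (sumOver-++ leafᵂ (map (node l) rs) (cartesianProductWith node ls rs))
          (cong₂ ℚ._+_ (maps l rs) (products ls rs))

-- Shapes of alternating trees and increasing subsequences

-- Parity of the size and direction of the first step; a single letter counts as up and as down.
oddUp evenUp evenDown oddDown : Tree → Bool
oddUp leaf          = false
oddUp (node l r)    = isLeaf l ∧ isLeaf r ∨ oddUp l ∧ oddUp r
evenUp leaf         = true
evenUp (node l r)   = oddUp l ∧ evenUp r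
evenDown leaf       = true
evenDown (node l r) = evenDown l ∧ oddUp r
oddDown leaf        = false
oddDown (node l r)  = evenDown l ∧ evenUp r

-- The number of occurrences of 1-2-⋯-k in the word of the tree (`occurrences-word`). The middle
-- summand stands for those ending at the maximum; since the empty sequence counts once, it also
-- supplies the maximum alone when k = 1.
inc : ℕ → Tree → ℕ
inc zero    t          = 1
inc (suc k) leaf       = 0
inc (suc k) (node l r) = inc (suc k) l + inc k l + inc (suc k) r

none once : ℕ → Tree → Bool
none k t = inc k t ≡ᵇ 0
once k t = inc k t ≡ᵇ 1

-- Dropping the first or the last letter of an increasing subsequence of length k + 2 gives two
-- different ones of length k + 1. On a node the critical term is `inc (suc k) l`: for k = 0 the
-- root already uses up the one letter allowed, and for larger k the bound on the middle summand
-- brings in the induction hypothesis for `l`.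
inc-drop : ∀ k t → inc (suc k) t ≤ 1 → inc (suc (suc k)) t ≡ 0
inc-drop k leaf _ = refl
inc-drop k (node l r) h = cong₂ _+_ (cong₂ _+_ (inc-drop k l l≤1) (left k h)) (inc-drop k r r≤1)
  where
  left : ∀ k → inc (suc k) (node l r) ≤ 1 → inc (suc k) l ≡ 0
  left zero    h = ℕₚ.n≤0⇒n≡0 (ℕ.s≤s⁻¹ (ℕₚ.≤-trans (ℕₚ.≤-reflexive (ℕₚ.+-comm 1 (inc 1 l)))
                     (ℕₚ.≤-trans (ℕₚ.m≤m+n _ (inc 1 r)) h)))
  left (suc k) h = inc-drop k l (ℕₚ.≤-trans (ℕₚ.m≤n+m _ (inc (suc (suc k)) l)) (ℕₚ.≤-trans (ℕₚ.m≤m+n _ _) h))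
  l≤1 : inc (suc k) l ≤ 1
  l≤1 = ℕₚ.≤-trans (ℕₚ.m≤m+n _ (inc k l)) (ℕₚ.≤-trans (ℕₚ.m≤m+n _ _) h)
  r≤1 : inc (suc k) r ≤ 1
  r≤1 = ℕₚ.≤-trans (ℕₚ.m≤n+m _ _) h

none-node : ∀ k l r → none (suc (suc k)) (node l r) ≡ none (suc k) l ∧ none (suc (suc k)) r
none-node k l r = go (inc (suc k) l) (inc (suc (suc k)) l) (inc (suc (suc k)) r) (inc-drop k l)
  where
  go : ∀ u v w → (u ≤ 1 → v ≡ 0) → (v + u + w ≡ᵇ 0) ≡ (u ≡ᵇ 0) ∧ (w ≡ᵇ 0)
  go zero    v w drop rewrite drop z≤n = refl
  go (suc u) v w drop rewrite ℕₚ.+-suc v u = refl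

-- The cases are the number u of shorter sequences in the left part: for u = 0 the occurrence lies
-- on the right, for u = 1 it ends at the maximum, and u ≥ 2 gives too many. In the first two cases
-- `inc-drop` removes the occurrences inside the left part. As the cases exclude each other, their
-- indicators add up.
once-node : ∀ k l r → indicator (once (suc (suc k)) (node l r)) ≡
  indicator (once (suc k) l) ℚ.* indicator (none (suc (suc k)) r) ℚ.+
  indicator (none (suc k) l) ℚ.* indicator (once (suc (suc k)) r)
once-node k l r = go (inc (suc k) l) (inc (suc (suc k)) l) (inc (suc (suc k)) r) (inc-drop k l)
  where
  open ℚSolver.+-*-Solver
  go : ∀ u v w → (u ≤ 1 → v ≡ 0) → indicator (v + u + w ≡ᵇ 1) ≡
    indicator (u ≡ᵇ 1) ℚ.* indicator (w ≡ᵇ 0) ℚ.+ indicator (u ≡ᵇ 0) ℚ.* indicator (w ≡ᵇ 1)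
  go zero          v w drop rewrite drop z≤n       =
    solve 2 (λ p q → q := con 0ℚ :* p :+ con 1ℚ :* q) refl (indicator (w ≡ᵇ 0)) (indicator (w ≡ᵇ 1))
  go (suc zero)    v w drop rewrite drop (s≤s z≤n) =
    solve 2 (λ p q → p := con 1ℚ :* p :+ con 0ℚ :* q) refl (indicator (w ≡ᵇ 0)) (indicator (w ≡ᵇ 1))
  go (suc (suc u)) v w drop rewrite ℕₚ.+-suc v (suc u) | ℕₚ.+-suc v u =
    solve 2 (λ p q → con 0ℚ := con 0ℚ :* p :+ con 0ℚ :* q) refl (indicator (w ≡ᵇ 0)) (indicator (w ≡ᵇ 1))

indicator-∧ : ∀ p q → indicator (p ∧ q) ≡ indicator p ℚ.* indicator q
indicator-∧ true  q = sym (ℚₚ.*-identityˡ (indicator q))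
indicator-∧ false q = sym (ℚₚ.*-zeroˡ (indicator q))

avoiding containing : (Tree → Bool) → ℕ → Tree → ℚ
avoiding   S k t = indicator (S t ∧ none k t)
containing S k t = indicator (S t ∧ once k t)

avoiding-node : ∀ P Q k l r →
  indicator ((P l ∧ Q r) ∧ none (suc (suc k)) (node l r)) ≡ (avoiding P (suc k) ⊠ avoiding Q (suc (suc k))) (node l r)
avoiding-node P Q k l r rewrite none-node k l r
  | indicator-∧ (P l ∧ Q r) (none (suc k) l ∧ none (suc (suc k)) r)
  | indicator-∧ (P l) (Q r) | indicator-∧ (none (suc k) l) (none (suc (suc k)) r)
  | indicator-∧ (P l) (none (suc k) l) | indicator-∧ (Q r) (none (suc (suc k)) r)
  = ℚ*.interchange (indicator (P l)) (indicator (Q r)) (indicator (none (suc k) l)) (indicator (none (suc (suc k)) r))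

containing-node : ∀ P Q k l r →
  indicator ((P l ∧ Q r) ∧ once (suc (suc k)) (node l r)) ≡
  (containing P (suc k) ⊠ avoiding Q (suc (suc k))) (node l r) ℚ.+
  (avoiding P (suc k) ⊠ containing Q (suc (suc k))) (node l r)
containing-node P Q k l r
  rewrite indicator-∧ (P l ∧ Q r) (once (suc (suc k)) (node l r))
  | indicator-∧ (P l) (Q r)
  | once-node k l r
  | indicator-∧ (P l) (none (suc k) l) | indicator-∧ (Q r) (none (suc (suc k)) r)
  | indicator-∧ (P l) (once (suc k) l) | indicator-∧ (Q r) (once (suc (suc k)) r)
  = solve 6 (λ p q a b c d → p :* q :* (a :* b :+ c :* d) := p :* a :* (q :* b) :+ p :* c :* (q :* d)) refl
      (indicator (P l)) (indicator (Q r))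
      (indicator (once (suc k) l)) (indicator (none (suc (suc k)) r))
      (indicator (none (suc k) l)) (indicator (once (suc (suc k)) r))
  where open ℚSolver.+-*-Solver

inc-1-node : ∀ l r → inc 1 (node l r) ≡ suc (inc 1 l + inc 1 r)
inc-1-node l r = cong (ℕ._+ inc 1 r) (ℕₚ.+-comm (inc 1 l) 1)

-- In the base cases the pattern is a single letter: only the empty word avoids it, and only words
-- of length one contain it once. Parity decides the rest.
a-zero-weight : ∀ t → avoiding oddUp 1 t ≡ 0ℚ
a-zero-weight leaf       = refl
a-zero-weight (node l r) rewrite inc-1-node l r | ∧-zeroʳ (oddUp (node l r)) = refl

c-zero-weight : ∀ t → avoiding evenDown 1 t ≡ leafᵂ t
c-zero-weight leaf       = refl
c-zero-weight (node l r) rewrite inc-1-node l r | ∧-zeroʳ (evenDown (node l r)) = refl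

A-zero-weight : ∀ t → containing oddUp 1 t ≡ (leafᵂ ⊠ leafᵂ) t
A-zero-weight leaf                     = refl
A-zero-weight (node leaf leaf)         = refl
A-zero-weight (node leaf (node _ _))   = refl
A-zero-weight (node (node l l′) r)
  rewrite inc-1-node (node l l′) r | inc-1-node l l′ | ∧-zeroʳ (oddUp (node (node l l′) r))
  = sym (ℚₚ.*-zeroˡ (leafᵂ r))

C-zero-weight : ∀ t → containing evenDown 1 t ≡ 0ℚ
C-zero-weight leaf = refl
C-zero-weight (node l leaf) rewrite ∧-zeroʳ (evenDown l) = refl
C-zero-weight (node l (node r r′))
  rewrite inc-1-node l (node r r′) | inc-1-node r r′ | ℕₚ.+-suc (inc 1 l) (inc 1 r + inc 1 r′)
  | ∧-zeroʳ (evenDown (node l (node r r′))) = refl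

-- The disjunction in `oddUp` becomes a sum because its alternatives exclude each other,
-- `oddUp leaf` being false. The single letter yields the term x; in `A-step-weight` that term is
-- absent, since one letter contains no longer pattern.
a-step-weight : ∀ k t → avoiding oddUp (suc (suc k)) t ≡
  (leafᵂ ⊠ leafᵂ) t ℚ.+ (avoiding oddUp (suc k) ⊠ avoiding oddUp (suc (suc k))) t
a-step-weight k leaf                   = refl
a-step-weight zero    (node leaf leaf) = refl
a-step-weight (suc k) (node leaf leaf) = refl
a-step-weight k (node leaf (node r r′)) = sym (trans (ℚₚ.+-identityˡ _) (ℚₚ.*-zeroˡ (avoiding oddUp (suc (suc k)) (node r r′))))
a-step-weight k (node l@(node _ _) r)  =
  trans (avoiding-node oddUp oddUp k l r)
        (sym (trans (cong (ℚ._+ (avoiding oddUp (suc k) ⊠ avoiding oddUp (suc (suc k))) (node l r)) (ℚₚ.*-zeroˡ (leafᵂ r)))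
                    (ℚₚ.+-identityˡ _)))

A-step-weight : ∀ k t → containing oddUp (suc (suc k)) t ≡
  (containing oddUp (suc k) ⊠ avoiding oddUp (suc (suc k))) t ℚ.+
  (avoiding oddUp (suc k) ⊠ containing oddUp (suc (suc k))) t
A-step-weight k leaf                   = refl
A-step-weight zero    (node leaf leaf) = refl
A-step-weight (suc k) (node leaf leaf) = refl
A-step-weight k (node leaf r@(node _ _)) = containing-node oddUp oddUp k leaf r
A-step-weight k (node l@(node _ _) r)  = containing-node oddUp oddUp k l r

b-step-weight : ∀ k t → avoiding evenUp (suc (suc k)) t ≡
  leafᵂ t ℚ.+ (avoiding oddUp (suc k) ⊠ avoiding evenUp (suc (suc k))) t
b-step-weight k leaf       = refl
b-step-weight k (node l r) = trans (avoiding-node oddUp evenUp k l r) (sym (ℚₚ.+-identityˡ _))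

B-step-weight : ∀ k t → containing evenUp (suc (suc k)) t ≡
  (containing oddUp (suc k) ⊠ avoiding evenUp (suc (suc k))) t ℚ.+
  (avoiding oddUp (suc k) ⊠ containing evenUp (suc (suc k))) t
B-step-weight k leaf       = refl
B-step-weight k (node l r) = containing-node oddUp evenUp k l r

c-step-weight : ∀ k t → avoiding evenDown (suc (suc k)) t ≡
  leafᵂ t ℚ.+ (avoiding evenDown (suc k) ⊠ avoiding oddUp (suc (suc k))) t
c-step-weight k leaf       = refl
c-step-weight k (node l r) = trans (avoiding-node evenDown oddUp k l r) (sym (ℚₚ.+-identityˡ _))

C-step-weight : ∀ k t → containing evenDown (suc (suc k)) t ≡
  (containing evenDown (suc k) ⊠ avoiding oddUp (suc (suc k))) t ℚ.+
  (avoiding evenDown (suc k) ⊠ containing oddUp (suc (suc k))) t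
C-step-weight k leaf       = refl
C-step-weight k (node l r) = containing-node evenDown oddUp k l r

D-step-weight : ∀ k t → containing oddDown (suc (suc k)) t ≡
  (containing evenDown (suc k) ⊠ avoiding evenUp (suc (suc k))) t ℚ.+
  (avoiding evenDown (suc k) ⊠ containing evenUp (suc (suc k))) t
D-step-weight k leaf       = refl
D-step-weight k (node l r) = containing-node evenDown evenUp k l r

-- Translation into Laurent series

module L = CommutativeRing Laurent-commutativeRing

series : (Tree → ℚ) → Laurent
series f = gf f ⊘x^ 0

series-cong : ∀ f g → (∀ t → f t ≡ g t) → series f ≈ series g
series-cong f g eq n = sumOver-cong eq (trees n)

series-+ : ∀ f g h → (∀ t → f t ≡ g t ℚ.+ h t) → series f ≈ series g ⊕ series h
series-+ f g h eq n = trans (sumOver-cong eq (trees n)) (sumOver-+ g h (trees n))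

series-⊠ : ∀ g h → series (g ⊠ h) ≈ xL ⊛ (series g ⊛ series h)
series-⊠ g h n = trans (gf-⊠ g h n) (shift-mono 1 (gf g *ₚ gf h) n)

series-leaf : series leafᵂ ≈ oneL
series-leaf = gf-leaf

series-0 : ∀ f → (∀ t → f t ≡ 0ℚ) → series f ≈ zeroL
series-0 f eq n = trans (sumOver-cong eq (trees n)) (trans (sumOver-0 (trees n)) (sym (constₚ0≐0 n)))

series-⊠+⊠ : ∀ f g h g′ h′ → (∀ t → f t ≡ (g ⊠ h) t ℚ.+ (g′ ⊠ h′) t) →
  series f ≈ xL ⊛ ((series g ⊛ series h) ⊕ (series g′ ⊛ series h′))
series-⊠+⊠ f g h g′ h′ eq = begin
  series f
    ≈⟨ series-+ f (g ⊠ h) (g′ ⊠ h′) eq ⟩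
  series (g ⊠ h) ⊕ series (g′ ⊠ h′)
    ≈⟨ ⊕-cong (series (g ⊠ h)) (xL ⊛ (series g ⊛ series h)) (series (g′ ⊠ h′)) (xL ⊛ (series g′ ⊛ series h′))
         (series-⊠ g h) (series-⊠ g′ h′) ⟩
  (xL ⊛ (series g ⊛ series h)) ⊕ (xL ⊛ (series g′ ⊛ series h′))
    ≈⟨ ⊛-distribˡ-⊕ xL (series g ⊛ series h) (series g′ ⊛ series h′) ⟨
  xL ⊛ ((series g ⊛ series h) ⊕ (series g′ ⊛ series h′)) ∎
  where open SetoidReasoning L.setoid

series-+⊠ : ∀ f g u h h′ → series g ≈ u → (∀ t → f t ≡ g t ℚ.+ (h ⊠ h′) t) →
  series f ≈ u ⊕ (xL ⊛ (series h ⊛ series h′))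
series-+⊠ f g u h h′ g≈u eq = begin
  series f
    ≈⟨ series-+ f g (h ⊠ h′) eq ⟩
  series g ⊕ series (h ⊠ h′)
    ≈⟨ ⊕-cong (series g) u (series (h ⊠ h′)) (xL ⊛ (series h ⊛ series h′)) g≈u (series-⊠ h h′) ⟩
  u ⊕ (xL ⊛ (series h ⊛ series h′)) ∎
  where open SetoidReasoning L.setoid

series-leaf² : series (leafᵂ ⊠ leafᵂ) ≈ xL
series-leaf² = begin
  series (leafᵂ ⊠ leafᵂ)
    ≈⟨ series-⊠ leafᵂ leafᵂ ⟩
  xL ⊛ (series leafᵂ ⊛ series leafᵂ)
    ≈⟨ ⊛-cong xL xL (series leafᵂ ⊛ series leafᵂ) (oneL ⊛ oneL) (λ _ → refl)
         (⊛-cong (series leafᵂ) oneL (series leafᵂ) oneL series-leaf series-leaf) ⟩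
  xL ⊛ (oneL ⊛ oneL)
    ≈⟨ ⊛-cong xL xL (oneL ⊛ oneL) oneL (λ _ → refl) (⊛-identityˡ oneL) ⟩
  xL ⊛ oneL
    ≈⟨ L.*-identityʳ xL ⟩
  xL ∎
  where open SetoidReasoning L.setoid

xL⁻¹ : Laurent
xL⁻¹ = constₚ 1ℚ ⊘x^ 1

xL⁻¹-inverse : xL⁻¹ ⊛ xL ≈ oneL
xL⁻¹-inverse n = *ₚ-identityˡ (mono 1) n

2·½x⁻¹ : twoL ⊛ halfInvX ≈ xL⁻¹
2·½x⁻¹ = shift-cong 1 (λ n → trans (constₚ-*ₚ (fromℕℚ 2) (constₚ ½) n) (coeff n))
  where
  coeff : scale (fromℕℚ 2) (constₚ ½) ≐ constₚ 1ℚ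
  coeff zero    = refl
  coeff (suc n) = refl

-- At t = 1/(2x) the coefficient 2t of the Chebyshev recurrence is 1/x; multiplying by x clears it.
V-step : ∀ j → (xL ⊛ Uₓprev (suc (suc j))) ⊕ (xL ⊛ Uₓprev j) ≈ Uₓprev (suc j)
V-step j = begin
  (xL ⊛ Uₓprev (suc (suc j))) ⊕ (xL ⊛ p)
    ≈⟨ ⊛-distribˡ-⊕ xL (Uₓprev (suc (suc j))) p ⟨
  xL ⊛ (((twoL ⊛ halfInvX ⊛ u) ⊕ (⊝ p)) ⊕ p)
    ≈⟨ ⊛-cong xL xL (((twoL ⊛ halfInvX ⊛ u) ⊕ (⊝ p)) ⊕ p) (xL⁻¹ ⊛ u) (λ _ → refl) (begin
      ((twoL ⊛ halfInvX ⊛ u) ⊕ (⊝ p)) ⊕ p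
        ≈⟨ ⊕-assoc (twoL ⊛ halfInvX ⊛ u) (⊝ p) p ⟩
      (twoL ⊛ halfInvX ⊛ u) ⊕ ((⊝ p) ⊕ p)
        ≈⟨ ⊕-cong (twoL ⊛ halfInvX ⊛ u) (xL⁻¹ ⊛ u) ((⊝ p) ⊕ p) zeroL
             (⊛-cong (twoL ⊛ halfInvX) xL⁻¹ u u 2·½x⁻¹ (λ _ → refl)) (⊝-inverseˡ p) ⟩
      (xL⁻¹ ⊛ u) ⊕ zeroL
        ≈⟨ L.+-identityʳ (xL⁻¹ ⊛ u) ⟩
      xL⁻¹ ⊛ u ∎) ⟩
  xL ⊛ (xL⁻¹ ⊛ u)
    ≈⟨ ⊛-assoc xL xL⁻¹ u ⟨
  (xL ⊛ xL⁻¹) ⊛ u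
    ≈⟨ ⊛-cong (xL ⊛ xL⁻¹) (xL⁻¹ ⊛ xL) u u (⊛-comm xL xL⁻¹) (λ _ → refl) ⟩
  (xL⁻¹ ⊛ xL) ⊛ u
    ≈⟨ ⊛-cong (xL⁻¹ ⊛ xL) oneL u u xL⁻¹-inverse (λ _ → refl) ⟩
  oneL ⊛ u
    ≈⟨ ⊛-identityˡ u ⟩
  u ∎
  where
  open SetoidReasoning L.setoid
  u = Uₓprev (suc j)
  p = Uₓprev j

recurrences : Recurrences Laurent-commutativeRing
recurrences = record
  { x = xL
  ; x⁻¹ = xL⁻¹
  ; a = λ j → series (avoiding oddUp (suc j))
  ; A = λ j → series (containing oddUp (suc j))
  ; b = λ j → series (avoiding evenUp (suc j))
  ; B = λ j → series (containing evenUp (suc j))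
  ; c = λ j → series (avoiding evenDown (suc j))
  ; C = λ j → series (containing evenDown (suc j))
  ; D = λ j → series (containing oddDown (suc j))
  ; V = Uₓprev
  ; X = xL ^L_
  ; inverse = xL⁻¹-inverse
  ; X-zero = λ _ → refl
  ; X-suc = λ _ _ → refl
  ; V-zero = λ _ → refl
  ; V-one = λ _ → refl
  ; V-step = V-step
  ; a-zero = series-0 (avoiding oddUp 1) a-zero-weight
  ; a-step = λ j → series-+⊠ (avoiding oddUp (suc (suc j))) (leafᵂ ⊠ leafᵂ) xL
      (avoiding oddUp (suc j)) (avoiding oddUp (suc (suc j))) series-leaf² (a-step-weight j)
  ; A-zero = L.trans {series (containing oddUp 1)} {series (leafᵂ ⊠ leafᵂ)} {xL}
      (series-cong (containing oddUp 1) (leafᵂ ⊠ leafᵂ) A-zero-weight) series-leaf²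
  ; A-step = λ j → series-⊠+⊠ (containing oddUp (suc (suc j)))
      (containing oddUp (suc j)) (avoiding oddUp (suc (suc j)))
      (avoiding oddUp (suc j)) (containing oddUp (suc (suc j))) (A-step-weight j)
  ; b-step = λ j → series-+⊠ (avoiding evenUp (suc (suc j))) leafᵂ oneL
      (avoiding oddUp (suc j)) (avoiding evenUp (suc (suc j))) series-leaf (b-step-weight j)
  ; B-step = λ j → series-⊠+⊠ (containing evenUp (suc (suc j)))
      (containing oddUp (suc j)) (avoiding evenUp (suc (suc j)))
      (avoiding oddUp (suc j)) (containing evenUp (suc (suc j))) (B-step-weight j)
  ; c-zero = L.trans {series (avoiding evenDown 1)} {series leafᵂ} {oneL}
      (series-cong (avoiding evenDown 1) leafᵂ c-zero-weight) series-leaf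
  ; c-step = λ j → series-+⊠ (avoiding evenDown (suc (suc j))) leafᵂ oneL
      (avoiding evenDown (suc j)) (avoiding oddUp (suc (suc j))) series-leaf (c-step-weight j)
  ; C-zero = series-0 (containing evenDown 1) C-zero-weight
  ; C-step = λ j → series-⊠+⊠ (containing evenDown (suc (suc j)))
      (containing evenDown (suc j)) (avoiding oddUp (suc (suc j)))
      (avoiding evenDown (suc j)) (containing oddUp (suc (suc j))) (C-step-weight j)
  ; D-step = λ j → series-⊠+⊠ (containing oddDown (suc (suc j)))
      (containing evenDown (suc j)) (avoiding evenUp (suc (suc j)))
      (avoiding evenDown (suc j)) (containing evenUp (suc (suc j))) (D-step-weight j)
  }

-- Words of trees

-- The letters fill the interval from m + 1 to m + `size t`: the right subtree takes the lowest
-- block, the left one the block above it, and the root the top value.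
word : Tree → ℕ → List ℕ
word leaf       m = []
word (node l r) m = word l (m + size r) ++ suc (m + size r + size l) ∷ word r m

length-word : ∀ t m → length (word t m) ≡ size t
length-word leaf       m = refl
length-word (node l r) m = begin
  length (word l (m + size r) ++ suc (m + size r + size l) ∷ word r m)
    ≡⟨ Listₚ.length-++ (word l (m + size r)) ⟩
  length (word l (m + size r)) + suc (length (word r m))
    ≡⟨ cong₂ (λ u v → u + suc v) (length-word l (m + size r)) (length-word r m) ⟩
  size l + suc (size r)
    ≡⟨ ℕₚ.+-suc (size l) (size r) ⟩
  suc (size l + size r) ∎
  where open ≡-Reasoning

InRange : ℕ → ℕ → ℕ → Set
InRange lo hi x = lo < x × x ≤ hi

inRange-mono : ∀ {lo lo′ hi hi′} → lo′ ≤ lo → hi ≤ hi′ → ∀ {x} → InRange lo hi x → InRange lo′ hi′ x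
inRange-mono lo′≤lo hi≤hi′ (lo<x , x≤hi) = ℕₚ.≤-<-trans lo′≤lo lo<x , ℕₚ.≤-trans x≤hi hi≤hi′

size-node-offset : ∀ m l r → suc (m + size r + size l) ≡ m + size (node l r)
size-node-offset m l r = begin
  suc (m + size r + size l)   ≡⟨ cong suc (ℕₚ.+-assoc m (size r) (size l)) ⟩
  suc (m + (size r + size l)) ≡⟨ cong (λ s → suc (m + s)) (ℕₚ.+-comm (size r) (size l)) ⟩
  suc (m + (size l + size r)) ≡⟨ ℕₚ.+-suc m (size l + size r) ⟨
  m + size (node l r)         ∎
  where open ≡-Reasoning

word-range : ∀ t m → All (InRange m (m + size t)) (word t m)
word-range leaf       m = []
word-range (node l r) m rewrite sym (size-node-offset m l r) = Allₚ.++⁺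
  (All.map (inRange-mono (ℕₚ.m≤m+n m (size r)) (ℕₚ.n≤1+n _)) (word-range l (m + size r)))
  ((s≤s (ℕₚ.≤-trans (ℕₚ.m≤m+n m (size r)) (ℕₚ.m≤m+n _ (size l))) , ℕₚ.≤-refl) ∷
   All.map (inRange-mono ℕₚ.≤-refl (ℕₚ.≤-trans (ℕₚ.m≤m+n _ (size l)) (ℕₚ.n≤1+n _))) (word-range r m))

-- The relation between the two sides of a maximum that avoidance of 1-3-2 forces
-- (`split-at-maximum`); it also suffices, once both sides avoid the pattern (`avoids132-split`).
record Split (L : List ℕ) (M : ℕ) (R : List ℕ) : Set where
  field
    left<  : All (_< M) L
    right< : All (_< M) R
    cross  : All (λ a → All (_< a) R) L

word-split : ∀ l r m → Split (word l (m + size r)) (suc (m + size r + size l)) (word r m)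
word-split l r m = record
  { left<  = All.map (s≤s ∘ proj₂) (word-range l (m + size r))
  ; right< = All.map (λ p → s≤s (ℕₚ.≤-trans (proj₂ p) (ℕₚ.m≤m+n _ (size l)))) (word-range r m)
  ; cross  = All.map (λ p → All.map (λ q → ℕₚ.≤-<-trans (proj₂ q) (proj₁ p)) (word-range r m))
                     (word-range l (m + size r))
  }

<ᵇ-true : ∀ {m n} → m < n → (m <ᵇ n) ≡ true
<ᵇ-true {m} {n} m<n with m <ᵇ n | ℕₚ.<⇒<ᵇ m<n
... | true | _ = refl

<ᵇ-false : ∀ {m n} → n ≤ m → (m <ᵇ n) ≡ false
<ᵇ-false {m} {n} n≤m with m <ᵇ n in eq
... | false = refl
... | true  = ⊥-elim (ℕₚ.<⇒≱ (ℕₚ.<ᵇ⇒< m n (subst T (sym eq) _)) n≤m)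

-- Increasing subsequences

-- The bound `a` is the letter chosen last, which makes the count of increasing subsequences
-- recursive along the word. On positive letters, a = 0 imposes nothing.
incAbove : ℕ → ℕ → List ℕ → ℕ
incAbove zero    a w       = 1
incAbove (suc k) a []      = 0
incAbove (suc k) a (x ∷ w) = (if a <ᵇ x then incAbove k x w else 0) + incAbove (suc k) a w

incAbove-zero : ∀ k {a w} → All (_≤ a) w → incAbove (suc k) a w ≡ 0
incAbove-zero k []                         = refl
incAbove-zero k {a} (_∷_ {x} x≤a w≤a) rewrite <ᵇ-false x≤a = incAbove-zero k w≤a

incAbove-split : ∀ k {a L M R} → Split L M R → a < M →
  incAbove (suc k) a (L ++ M ∷ R) ≡ incAbove (suc k) a L + incAbove k a L + incAbove (suc k) a R
incAbove-split k {a} {[]} {M} {R} s a<M rewrite <ᵇ-true a<M = cong (_+ incAbove (suc k) a R) (top k)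
  where
  top : ∀ k → incAbove k M R ≡ incAbove k a []
  top zero    = refl
  top (suc k) = incAbove-zero k (All.map ℕₚ.<⇒≤ (Split.right< s))
incAbove-split k {a} {x ∷ L} {M} {R}
  record { left< = x<M ∷ L<M ; right< = R<M ; cross = R<x ∷ cross } a<M =
  trans (cong ((if a <ᵇ x then incAbove k x (L ++ M ∷ R) else 0) +_) (incAbove-split k tail-split a<M))
        (step k)
  where
  tail-split : Split L M R
  tail-split = record { left< = L<M ; right< = R<M ; cross = cross }
  open ℕSolver.+-*-Solver
  step : ∀ k →
    (if a <ᵇ x then incAbove k x (L ++ M ∷ R) else 0) +
      (incAbove (suc k) a L + incAbove k a L + incAbove (suc k) a R) ≡
    (if a <ᵇ x then incAbove k x L else 0) + incAbove (suc k) a L + incAbove k a (x ∷ L) + incAbove (suc k) a R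
  step zero = solve 4 (λ u p o q → u :+ (p :+ o :+ q) := u :+ p :+ o :+ q) refl
    (if a <ᵇ x then 1 else 0) (incAbove 1 a L) 1 (incAbove 1 a R)
  -- A sequence that has taken x cannot continue into R, which lies below x, so that contribution
  -- becomes 0.
  step (suc k) rewrite incAbove-split k tail-split x<M | incAbove-zero k (All.map ℕₚ.<⇒≤ R<x) with a <ᵇ x
  ... | true  = solve 5 (λ u v p o q → u :+ v :+ con 0 :+ (p :+ o :+ q) := u :+ p :+ (v :+ o) :+ q) refl
    (incAbove (suc k) x L) (incAbove k x L) (incAbove (suc (suc k)) a L) (incAbove (suc k) a L) (incAbove (suc (suc k)) a R)
  ... | false = refl

incAbove-word : ∀ k t m → incAbove k 0 (word t m) ≡ inc k t
incAbove-word zero    t          m = refl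
incAbove-word (suc k) leaf       m = refl
incAbove-word (suc k) (node l r) m = trans
  (incAbove-split k (word-split l r m) (s≤s z≤n))
  (cong₂ _+_ (cong₂ _+_ (incAbove-word (suc k) l (m + size r)) (incAbove-word k l (m + size r)))
             (incAbove-word (suc k) r m))

module _ {A : Set} where

  count-cong : ∀ {p q : A → Bool} → (∀ x → p x ≡ q x) → ∀ xs → count p xs ≡ count q xs
  count-cong eq []       = refl
  count-cong eq (x ∷ xs) rewrite eq x | count-cong eq xs = refl

  count-cong-local : ∀ {p q : A → Bool} {xs} → All (λ x → p x ≡ q x) xs → count p xs ≡ count q xs
  count-cong-local []         = refl
  count-cong-local (eq ∷ eqs) rewrite eq | count-cong-local eqs = refl

  count-++ : ∀ (p : A → Bool) xs ys → count p (xs ++ ys) ≡ count p xs + count p ys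
  count-++ p []       ys = refl
  count-++ p (x ∷ xs) ys with p x
  ... | true  = cong suc (count-++ p xs ys)
  ... | false = count-++ p xs ys

  count-false : ∀ (xs : List A) → count (λ _ → false) xs ≡ 0
  count-false []       = refl
  count-false (x ∷ xs) = count-false xs

  count-map : ∀ {B : Set} (p : A → Bool) (f : B → A) xs → count p (map f xs) ≡ count (p ∘ f) xs
  count-map p f []       = refl
  count-map p f (x ∷ xs) rewrite count-map p f xs = refl

allAbove : ℕ → List ℕ → Bool
allAbove a []      = true
allAbove a (x ∷ s) = (a <ᵇ x) ∧ allAbove a s

allAbove-mono : ∀ {a x} → a < x → ∀ s → allAbove a s ∧ allAbove x s ≡ allAbove x s
allAbove-mono a<x []      = refl
allAbove-mono {a} {x} a<x (y ∷ s) with x <ᵇ y in eq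
... | false = ∧-zeroʳ _
... | true rewrite <ᵇ-true (ℕₚ.<-trans a<x (ℕₚ.<ᵇ⇒< x y (subst T (sym eq) _))) = allAbove-mono a<x s

-- The local function of orderIso has no name outside Defs; unification recovers it.
compareFirst : Σ (ℕ → ℕ → List ℕ → List ℕ → Bool) λ g →
  ∀ a b as bs → orderIso (a ∷ as) (b ∷ bs) ≡ g a b as bs ∧ orderIso as bs
compareFirst = _ , λ a b as bs → refl

sameOrder-asc : ∀ a a′ {b b′} → b < b′ → sameOrder a a′ b b′ ≡ (a <ᵇ a′)
sameOrder-asc a a′ {b} {b′} b<b′ rewrite <ᵇ-true b<b′ | <ᵇ-false (ℕₚ.<⇒≤ b<b′) with a <ᵇ a′ in eq
... | false = refl
... | true rewrite <ᵇ-false (ℕₚ.<⇒≤ (ℕₚ.<ᵇ⇒< a a′ (subst T (sym eq) _))) = refl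

-- Against an ascending pattern, comparing the first letter with the others only asks them to be
-- larger. The conjunct `orderIso s τ` stays on both sides because `allAbove` does not notice a
-- mismatch of lengths.
compareFirst-asc : ∀ a {b} s {τ} → All (b <_) τ →
  proj₁ compareFirst a b s τ ∧ orderIso s τ ≡ allAbove a s ∧ orderIso s τ
compareFirst-asc a []      []      = refl
compareFirst-asc a []      (_ ∷ _) = refl
compareFirst-asc a (x ∷ s) []      = sym (∧-zeroʳ _)
compareFirst-asc a {b} (x ∷ s) {c ∷ τ} (b<c ∷ b<τ) rewrite sameOrder-asc a x b<c =
  bools (a <ᵇ x) (proj₁ compareFirst a b s τ) (allAbove a s) (proj₁ compareFirst x c s τ) (orderIso s τ)
    (compareFirst-asc a s b<τ)
  where
  bools : ∀ p g g′ h o → g ∧ o ≡ g′ ∧ o → (p ∧ g) ∧ (h ∧ o) ≡ (p ∧ g′) ∧ (h ∧ o)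
  bools p g g′ h false _ rewrite ∧-zeroʳ h | ∧-zeroʳ (p ∧ g) | ∧-zeroʳ (p ∧ g′) = refl
  bools p g g′ h true eq rewrite ∧-identityʳ g | ∧-identityʳ g′ | eq = refl

-- Stated for every ascending pattern, since the tail of `incPat k` is not of the form `incPat`, and
-- with a lower bound, since the recursion of `incAbove` raises it.
count-ascending : ∀ {τ} → AllPairs _<_ τ → ∀ a w →
  count (λ s → allAbove a s ∧ orderIso s τ) (choose (length τ) w) ≡ incAbove (length τ) a w
count-ascending []                      a w       = refl
count-ascending (_ ∷ _)                 a []      = refl
count-ascending {b ∷ τ} (b<τ ∷ τ-asc) a (x ∷ w) = begin
  count P (map (x ∷_) (choose (length τ) w) ++ choose (suc (length τ)) w)
    ≡⟨ count-++ P (map (x ∷_) (choose (length τ) w)) _ ⟩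
  count P (map (x ∷_) (choose (length τ) w)) + count P (choose (suc (length τ)) w)
    ≡⟨ cong₂ _+_ (count-map P (x ∷_) (choose (length τ) w)) (count-ascending (b<τ ∷ τ-asc) a w) ⟩
  count (λ s → P (x ∷ s)) (choose (length τ) w) + incAbove (suc (length τ)) a w
    ≡⟨ cong (_+ incAbove (suc (length τ)) a w) first ⟩
  (if a <ᵇ x then incAbove (length τ) x w else 0) + incAbove (suc (length τ)) a w ∎
  where
  open ≡-Reasoning
  P : List ℕ → Bool
  P s = allAbove a s ∧ orderIso s (b ∷ τ)
  first : count (λ s → P (x ∷ s)) (choose (length τ) w) ≡ (if a <ᵇ x then incAbove (length τ) x w else 0)
  first with a <ᵇ x in eq
  ... | false = count-false (choose (length τ) w)
  ... | true  = trans (count-cong pointwise (choose (length τ) w)) (count-ascending τ-asc x w)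
    where
    a<x : a < x
    a<x = ℕₚ.<ᵇ⇒< a x (subst T (sym eq) _)
    pointwise : ∀ s → allAbove a s ∧ (proj₁ compareFirst x b s τ ∧ orderIso s τ) ≡ allAbove x s ∧ orderIso s τ
    pointwise s = trans (cong (allAbove a s ∧_) (compareFirst-asc x s b<τ))
      (trans (sym (∧-assoc (allAbove a s) (allAbove x s) (orderIso s τ)))
             (cong (_∧ orderIso s τ) (allAbove-mono a<x s)))

choose-All : ∀ {P : ℕ → Set} k {w} → All P w → All (All P) (choose k w)
choose-All zero    _          = [] ∷ []
choose-All (suc k) []         = []
choose-All (suc k) (px ∷ pw)  =
  Allₚ.++⁺ (Allₚ.map⁺ (All.map (px ∷_) (choose-All k pw))) (choose-All (suc k) pw)

allAbove-0 : ∀ {s} → All (0 <_) s → allAbove 0 s ≡ true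
allAbove-0 []                         = refl
allAbove-0 (0<x ∷ 0<s) rewrite <ᵇ-true 0<x = allAbove-0 0<s

incPat-ascending : ∀ k → AllPairs _<_ (incPat k)
incPat-ascending k = AllPairsₚ.map⁺ (AllPairsₚ.applyUpTo⁺₁ (λ i → i) k (λ i<j _ → s≤s i<j))

occurrences-incPat : ∀ k {w} → All (0 <_) w → occurrences (incPat k) w ≡ incAbove k 0 w
occurrences-incPat k {w} 0<w = begin
  count (λ s → orderIso s (incPat k)) (choose (length (incPat k)) w)
    ≡⟨ count-cong-local (All.map (λ {s} 0<s → cong (_∧ orderIso s (incPat k)) (sym (allAbove-0 0<s)))
         (choose-All (length (incPat k)) 0<w)) ⟩
  count (λ s → allAbove 0 s ∧ orderIso s (incPat k)) (choose (length (incPat k)) w)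
    ≡⟨ count-ascending (incPat-ascending k) 0 w ⟩
  incAbove (length (incPat k)) 0 w
    ≡⟨ cong (λ n → incAbove n 0 w) (trans (Listₚ.length-map suc (upTo k)) (Listₚ.length-upTo k)) ⟩
  incAbove k 0 w ∎
  where open ≡-Reasoning

occurrences-word : ∀ k t m → occurrences (incPat k) (word t m) ≡ inc k t
occurrences-word k t m = trans
  (occurrences-incPat k (All.map (λ p → ℕₚ.≤-<-trans z≤n (proj₁ p)) (word-range t m)))
  (incAbove-word k t m)

-- Alternation of the words of trees

alt-peak : ∀ {M R} → All (_< M) R → alt false (M ∷ R) ≡ alt true R
alt-peak []                          = refl
alt-peak (r<M ∷ _) rewrite <ᵇ-true r<M = refl

-- The step into M is an ascent, and the parity of the left part decides whether the alternation
-- allows an ascent there. An empty left part has no such step, which is why `leaf` on the left is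
-- treated apart for words starting upwards.
alt-split : ∀ up x L {M R} → All (_< M) (x ∷ L) → All (_< M) R →
  alt up (x ∷ L ++ M ∷ R) ≡ (isOdd (length (x ∷ L)) ==ᴮ up) ∧ (alt up (x ∷ L) ∧ alt true R)
alt-split true  x [] (x<M ∷ _) R<M rewrite <ᵇ-true x<M                 = alt-peak R<M
alt-split false x [] (x<M ∷ _) R<M rewrite <ᵇ-false (ℕₚ.<⇒≤ x<M) = refl
alt-split up x (y ∷ L) {M} {R} (_ ∷ L<M) R<M = trans
  (cong ((if up then x <ᵇ y else y <ᵇ x) ∧_) (alt-split (not up) y L L<M R<M))
  (bools up (isOdd (length L)) (if up then x <ᵇ y else y <ᵇ x) (alt (not up) (y ∷ L)) (alt true R))
  where
  bools : ∀ u p c α β → c ∧ ((not p ==ᴮ not u) ∧ (α ∧ β)) ≡ (not (not p) ==ᴮ u) ∧ ((c ∧ α) ∧ β)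
  bools true  true  true  α β = refl
  bools true  true  false α β = refl
  bools true  false true  α β = refl
  bools true  false false α β = refl
  bools false true  true  α β = refl
  bools false true  false α β = refl
  bools false false true  α β = refl
  bools false false false α β = refl

isOdd-+ : ∀ m n → isOdd (m + n) ≡ isOdd m xor isOdd n
isOdd-+ zero    n = refl
isOdd-+ (suc m) n rewrite isOdd-+ m n with isOdd m
... | true  = not-involutive (isOdd n)
... | false = refl

alt-nonempty : ∀ up L {M R} → 0 < length L → All (_< M) L → All (_< M) R →
  alt up (L ++ M ∷ R) ≡ (isOdd (length L) ==ᴮ up) ∧ (alt up L ∧ alt true R)
alt-nonempty up (x ∷ L) _ L<M R<M = alt-split up x L L<M R<M

alt-node : ∀ up l r m → 0 < size l →
  alt up (word (node l r) m) ≡ (isOdd (size l) ==ᴮ up) ∧ (alt up (word l (m + size r)) ∧ alt true (word r m))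
alt-node up l r m 0<l = trans
  (alt-nonempty up (word l (m + size r)) (subst (0 <_) (sym (length-word l (m + size r))) 0<l)
    (Split.left< (word-split l r m)) (Split.right< (word-split l r m)))
  (cong (λ n → (isOdd n ==ᴮ up) ∧ (alt up (word l (m + size r)) ∧ alt true (word r m)))
        (length-word l (m + size r)))

alt-false-node : ∀ l r m →
  alt false (word (node l r) m) ≡ not (isOdd (size l)) ∧ (alt false (word l (m + size r)) ∧ alt true (word r m))
alt-false-node leaf         r m = alt-peak (Split.right< (word-split leaf r m))
alt-false-node l@(node _ _) r m = trans (alt-node false l r m (s≤s z≤n)) (cong (_∧ (alt false (word l (m + size r)) ∧ alt true (word r m))) (==ᴮ-false (isOdd (size l))))
  where
  ==ᴮ-false : ∀ b → (b ==ᴮ false) ≡ not b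
  ==ᴮ-false true  = refl
  ==ᴮ-false false = refl

alt-true-leaf : ∀ r r′ m → alt true (word (node leaf (node r r′)) m) ≡ false
alt-true-leaf r r′ m = go (word (node r r′) m)
    (subst (0 <_) (sym (length-word (node r r′) m)) (s≤s z≤n)) (Split.right< (word-split leaf (node r r′) m))
  where
  go : ∀ R {M} → 0 < length R → All (_< M) R → alt true (M ∷ R) ≡ false
  go (x ∷ R) _ (x<M ∷ _) rewrite <ᵇ-false (ℕₚ.<⇒≤ x<M) = refl

-- The parity of the whole word and the peak condition of `alt-node` determine the parities of both
-- parts; `bools` expresses this so that the induction hypotheses apply to the two sides separately.
-- The other three shapes follow the same scheme.
oddUp-word    : ∀ t m → isOdd (size t) ∧ alt true (word t m) ≡ oddUp t
oddUp-word leaf                    m = refl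
oddUp-word (node leaf leaf)        m = refl
oddUp-word (node leaf r@(node r₁ r₂)) m rewrite alt-true-leaf r₁ r₂ m = ∧-zeroʳ (isOdd (size (node leaf r)))
oddUp-word (node l@(node _ _) r)   m = trans
  (cong₂ _∧_ (cong not (isOdd-+ (size l) (size r))) (alt-node true l r m (s≤s z≤n)))
  (trans (bools (isOdd (size l)) (isOdd (size r)) (alt true (word l (m + size r))) (alt true (word r m)))
         (cong₂ _∧_ (oddUp-word l (m + size r)) (oddUp-word r m)))
  where
  bools : ∀ p s α β → not (p xor s) ∧ ((p ==ᴮ true) ∧ (α ∧ β)) ≡ (p ∧ α) ∧ (s ∧ β)
  bools true  true  α     β = refl
  bools true  false true  β = refl
  bools true  false false β = refl
  bools false true  α     β = refl
  bools false false α     β = refl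

evenUp-word   : ∀ t m → not (isOdd (size t)) ∧ alt true (word t m) ≡ evenUp t
evenUp-word leaf                    m = refl
evenUp-word (node leaf leaf)        m = refl
evenUp-word (node leaf r@(node r₁ r₂)) m rewrite alt-true-leaf r₁ r₂ m = ∧-zeroʳ (not (isOdd (size (node leaf r))))
evenUp-word (node l@(node _ _) r)   m = trans
  (cong₂ _∧_ (cong (not ∘ not) (isOdd-+ (size l) (size r))) (alt-node true l r m (s≤s z≤n)))
  (trans (bools (isOdd (size l)) (isOdd (size r)) (alt true (word l (m + size r))) (alt true (word r m)))
         (cong₂ _∧_ (oddUp-word l (m + size r)) (evenUp-word r m)))
  where
  bools : ∀ p s α β → not (not (p xor s)) ∧ ((p ==ᴮ true) ∧ (α ∧ β)) ≡ (p ∧ α) ∧ (not s ∧ β)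
  bools true  true  true  β = refl
  bools true  true  false β = refl
  bools true  false α     β = refl
  bools false true  α     β = refl
  bools false false α     β = refl

evenDown-word : ∀ t m → not (isOdd (size t)) ∧ alt false (word t m) ≡ evenDown t
evenDown-word leaf       m = refl
evenDown-word (node l r) m = trans
  (cong₂ _∧_ (cong (not ∘ not) (isOdd-+ (size l) (size r))) (alt-false-node l r m))
  (trans (bools (isOdd (size l)) (isOdd (size r)) (alt false (word l (m + size r))) (alt true (word r m)))
         (cong₂ _∧_ (evenDown-word l (m + size r)) (oddUp-word r m)))
  where
  bools : ∀ p s α β → not (not (p xor s)) ∧ (not p ∧ (α ∧ β)) ≡ (not p ∧ α) ∧ (s ∧ β)
  bools true  true  α     β = refl
  bools true  false α     β = refl
  bools false true  α     β = refl
  bools false false true  β = refl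
  bools false false false β = refl

oddDown-word  : ∀ t m → isOdd (size t) ∧ alt false (word t m) ≡ oddDown t
oddDown-word leaf       m = refl
oddDown-word (node l r) m = trans
  (cong₂ _∧_ (cong not (isOdd-+ (size l) (size r))) (alt-false-node l r m))
  (trans (bools (isOdd (size l)) (isOdd (size r)) (alt false (word l (m + size r))) (alt true (word r m)))
         (cong₂ _∧_ (evenDown-word l (m + size r)) (evenUp-word r m)))
  where
  bools : ∀ p s α β → not (p xor s) ∧ (not p ∧ (α ∧ β)) ≡ (not p ∧ α) ∧ (not s ∧ β)
  bools true  true  α     β = refl
  bools true  false α     β = refl
  bools false true  true  β = refl
  bools false true  false β = refl
  bools false false α     β = refl

-- Avoidance of 1-3-2

Avoids132 : List ℕ → Set
Avoids132 w = ∀ {a b c} → (a ∷ b ∷ c ∷ []) ⊆ w → a < c → c < b → ⊥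

choose⇒⊆ : ∀ k w {s} → s ∈ choose k w → s ⊆ w × length s ≡ k
choose⇒⊆ zero    []      (here refl) = [] , refl
choose⇒⊆ zero    (x ∷ w) (here refl) = Sublist.minimum (x ∷ w) , refl
choose⇒⊆ (suc k) (x ∷ w) s∈ with ∈ₚ.∈-++⁻ (map (x ∷_) (choose k w)) s∈
... | inj₂ s∈′ = let s⊆w , len = choose⇒⊆ (suc k) w s∈′ in x ∷ʳ s⊆w , len
... | inj₁ s∈′ with ∈ₚ.∈-map⁻ (x ∷_) s∈′
... | s , s∈″ , refl = let s⊆w , len = choose⇒⊆ k w s∈″ in refl ∷ s⊆w , cong suc len

⊆⇒choose : ∀ {s w} → s ⊆ w → s ∈ choose (length s) w
⊆⇒choose {[]}              _            = here refl
⊆⇒choose {x ∷ s} {.y ∷ w}  (y ∷ʳ s⊆w)   = ∈ₚ.∈-++⁺ʳ (map (y ∷_) (choose (length s) w)) (⊆⇒choose s⊆w)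
⊆⇒choose {x ∷ s} {.x ∷ w}  (refl ∷ s⊆w) = ∈ₚ.∈-++⁺ˡ (∈ₚ.∈-map⁺ (x ∷_) (⊆⇒choose s⊆w))

module _ {A : Set} where

  count≡0⇒ : ∀ (p : A → Bool) {xs x} → count p xs ≡ 0 → x ∈ xs → ¬ T (p x)
  count≡0⇒ p {y ∷ xs} eq (here refl) px with p y
  ... | true with () ← eq
  count≡0⇒ p {y ∷ xs} eq (there x∈) px with p y
  ... | false = count≡0⇒ p eq x∈ px

  ⇒count≡0 : ∀ (p : A → Bool) xs → (∀ {x} → x ∈ xs → ¬ T (p x)) → count p xs ≡ 0
  ⇒count≡0 p []       h = refl
  ⇒count≡0 p (x ∷ xs) h with p x in eq
  ... | true  = ⊥-elim (h (here refl) (subst T (sym eq) _))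
  ... | false = ⇒count≡0 p xs (h ∘ there)

orderIso-132⁺ : ∀ {a b c} → a < c → c < b → T (orderIso (a ∷ b ∷ c ∷ []) p132)
orderIso-132⁺ a<c c<b
  rewrite <ᵇ-true a<c | <ᵇ-false (ℕₚ.<⇒≤ a<c) | <ᵇ-true c<b | <ᵇ-false (ℕₚ.<⇒≤ c<b)
        | <ᵇ-true (ℕₚ.<-trans a<c c<b) | <ᵇ-false (ℕₚ.<⇒≤ (ℕₚ.<-trans a<c c<b)) = _

orderIso-132⁻ : ∀ {a b c} → T (orderIso (a ∷ b ∷ c ∷ []) p132) → a < c × c < b
orderIso-132⁻ {a} {b} {c} h = ℕₚ.<ᵇ⇒< a c (up (a <ᵇ c) ac) , ℕₚ.<ᵇ⇒< c b (up (c <ᵇ b) bc)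
  where
  split : ∀ {x y} → T (x ∧ y) → T x × T y
  split = Equivalence.to T-∧
  up : ∀ x → T (x ==ᴮ true) → T x
  up true _ = _
  ac : T ((a <ᵇ c) ==ᴮ true)
  ac = proj₁ (split {y = (c <ᵇ a) ==ᴮ false} (proj₁ (split {y = true} (proj₂ (split {sameOrder a b 1 3} (proj₁ (split h)))))))
  bc : T ((c <ᵇ b) ==ᴮ true)
  bc = proj₂ (split {(b <ᵇ c) ==ᴮ false} (proj₁ (split {y = true} (proj₁ (split (proj₂ (split {sameOrder a b 1 3 ∧ sameOrder a c 1 2 ∧ true} h)))))))

avoids132⁺ : ∀ w → Avoids132 w → T (occurrences p132 w ≡ᵇ 0)
avoids132⁺ w av = ℕₚ.≡⇒≡ᵇ (occurrences p132 w) 0 (⇒count≡0 _ (choose 3 w) λ {s} s∈ → go s (choose⇒⊆ 3 w s∈))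
  where
  go : ∀ s → s ⊆ w × length s ≡ 3 → ¬ T (orderIso s p132)
  go (a ∷ b ∷ c ∷ []) (s⊆w , _) iso = let a<c , c<b = orderIso-132⁻ iso in av s⊆w a<c c<b

avoids132⁻ : ∀ w → T (occurrences p132 w ≡ᵇ 0) → Avoids132 w
avoids132⁻ w h s⊆w a<c c<b =
  count≡0⇒ (λ s → orderIso s p132) (ℕₚ.≡ᵇ⇒≡ (occurrences p132 w) 0 h) (⊆⇒choose s⊆w) (orderIso-132⁺ a<c c<b)

⊆-++⁻ : ∀ xs {ys s : List ℕ} → s ⊆ xs ++ ys → ∃₂ λ s₁ s₂ → s ≡ s₁ ++ s₂ × s₁ ⊆ xs × s₂ ⊆ ys
⊆-++⁻ []       s⊆          = [] , _ , refl , [] , s⊆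
⊆-++⁻ (x ∷ xs) (.x ∷ʳ s⊆)  = let s₁ , s₂ , eq , p , q = ⊆-++⁻ xs s⊆ in s₁ , s₂ , eq , x ∷ʳ p , q
⊆-++⁻ (x ∷ xs) (refl ∷ s⊆) = let s₁ , s₂ , eq , p , q = ⊆-++⁻ xs s⊆ in x ∷ s₁ , s₂ , cong (x ∷_) eq , refl ∷ p , q

-- The cases are how many of a, b, c fall into L. In a mixed case, or when a is M itself, a < c < b
-- fails: either c lies in R and hence below a, or M would have to be smaller than another letter.
avoids132-split : ∀ {L M R} → Split L M R → Avoids132 L → Avoids132 R → Avoids132 (L ++ M ∷ R)
avoids132-split {L} {M} {R} sp avL avR {a} {b} {c} s⊆ a<c c<b with ⊆-++⁻ L s⊆
... | [] , _ , refl , _ , M ∷ʳ s⊆R = avR s⊆R a<c c<b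
... | [] , _ , refl , _ , refl ∷ s⊆R with Sublistₚ.All-resp-⊆ s⊆R (Split.right< sp)
...   | _ ∷ c<M ∷ [] = ℕₚ.<-asym a<c c<M
avoids132-split {L} {M} {R} sp avL avR {a} {b} {c} s⊆ a<c c<b
    | _ ∷ [] , _ , refl , a⊆L , bc⊆ with bc⊆ | Sublistₚ.All-resp-⊆ a⊆L (Split.cross sp)
...   | M ∷ʳ bc⊆R | R<a ∷ [] with Sublistₚ.All-resp-⊆ bc⊆R R<a
...     | _ ∷ c<a ∷ [] = ℕₚ.<-asym a<c c<a
avoids132-split {L} {M} {R} sp avL avR {a} {b} {c} s⊆ a<c c<b
    | _ ∷ [] , _ , refl , a⊆L , bc⊆ | refl ∷ c⊆R | R<a ∷ [] with Sublistₚ.All-resp-⊆ c⊆R R<a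
...     | c<a ∷ [] = ℕₚ.<-asym a<c c<a
avoids132-split {L} {M} {R} sp avL avR {a} {b} {c} s⊆ a<c c<b
    | _ ∷ _ ∷ [] , _ , refl , ab⊆L , c⊆ with c⊆ | Sublistₚ.All-resp-⊆ ab⊆L (Split.cross sp) | Sublistₚ.All-resp-⊆ ab⊆L (Split.left< sp)
...   | M ∷ʳ c⊆R | R<a ∷ _ | _ with Sublistₚ.All-resp-⊆ c⊆R R<a
...     | c<a ∷ [] = ℕₚ.<-asym a<c c<a
avoids132-split {L} {M} {R} sp avL avR {a} {b} {c} s⊆ a<c c<b
    | _ ∷ _ ∷ [] , _ , refl , ab⊆L , c⊆ | refl ∷ _ | _ | _ ∷ b<M ∷ [] = ℕₚ.<-asym c<b b<M
avoids132-split {L} {M} {R} sp avL avR {a} {b} {c} s⊆ a<c c<b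
    | _ ∷ _ ∷ _ ∷ [] , _ , refl , abc⊆L , _ = avL abc⊆L a<c c<b

word-avoids132 : ∀ t m → Avoids132 (word t m)
word-avoids132 leaf       m ()
word-avoids132 (node l r) m =
  avoids132-split (word-split l r m) (word-avoids132 l (m + size r)) (word-avoids132 r m)

-- Distinct letters, and recovery of a tree from its word

notIn⁺ : ∀ {a w} → All (a ≢_) w → T (notIn a w)
notIn⁺ []                            = _
notIn⁺ {a} (_∷_ {x} a≢x a∉w) with a ≡ᵇ x in eq
... | true  = a≢x (ℕₚ.≡ᵇ⇒≡ a x (subst T (sym eq) _))
... | false = notIn⁺ a∉w

notIn⁻ : ∀ a w → T (notIn a w) → All (a ≢_) w
notIn⁻ a []      _ = []
notIn⁻ a (x ∷ w) h with a ≡ᵇ x in eq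
... | false = (λ a≡x → subst T eq (ℕₚ.≡⇒≡ᵇ a x a≡x)) ∷ notIn⁻ a w h

distinct⁺ : ∀ {w} → Unique w → T (distinct w)
distinct⁺ []          = _
distinct⁺ (a∉w ∷ uw) = Equivalence.from T-∧ (notIn⁺ a∉w , distinct⁺ uw)

distinct⁻ : ∀ w → T (distinct w) → Unique w
distinct⁻ []      _ = []
distinct⁻ (a ∷ w) h = let p , q = Equivalence.to T-∧ h in notIn⁻ a w p ∷ distinct⁻ w q

split-unique : ∀ {L M R} → Split L M R → Unique L → Unique R → Unique (L ++ M ∷ R)
split-unique {L} {M} {R} sp uL uR = Uniqueₚ.++⁺ uL
  (All.map (λ r<M M≡r → ℕₚ.<⇒≢ r<M (sym M≡r)) (Split.right< sp) ∷ uR)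
  λ where
    (x∈L , here refl) → ℕₚ.<-irrefl refl (All.lookup (Split.left< sp) x∈L)
    (x∈L , there x∈R) → ℕₚ.<-irrefl refl (All.lookup (All.lookup (Split.cross sp) x∈L) x∈R)

word-unique : ∀ t m → Unique (word t m)
word-unique leaf       m = []
word-unique (node l r) m = split-unique (word-split l r m) (word-unique l (m + size r)) (word-unique r m)

-- Letters before M are smaller than M, so both decompositions cut the word at the first M.
++-∷-injective : ∀ {M : ℕ} L L′ {R R′} → All (_< M) L → All (_< M) L′ →
  L ++ M ∷ R ≡ L′ ++ M ∷ R′ → L ≡ L′ × R ≡ R′
++-∷-injective []      []       _         _          eq   = refl , Listₚ.∷-injectiveʳ eq
++-∷-injective []      (x ∷ L′) _         (x<M ∷ _)  eq   = ⊥-elim (ℕₚ.<⇒≢ x<M (sym (Listₚ.∷-injectiveˡ eq)))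
++-∷-injective (x ∷ L) []       (x<M ∷ _) _          eq   = ⊥-elim (ℕₚ.<⇒≢ x<M (Listₚ.∷-injectiveˡ eq))
++-∷-injective (x ∷ L) (y ∷ L′) (_ ∷ L<M) (_ ∷ L′<M) eq =
  let L≡L′ , R≡R′ = ++-∷-injective L L′ L<M L′<M (Listₚ.∷-injectiveʳ eq)
  in cong₂ _∷_ (Listₚ.∷-injectiveˡ eq) L≡L′ , R≡R′

word-size : ∀ t t′ m → word t m ≡ word t′ m → size t ≡ size t′
word-size t t′ m eq = trans (sym (length-word t m)) (trans (cong length eq) (length-word t′ m))

word-injective : ∀ t t′ m → word t m ≡ word t′ m → t ≡ t′
word-injective leaf       leaf         m eq = refl
word-injective leaf       (node l′ r′) m eq with word-size leaf (node l′ r′) m eq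
... | ()
word-injective (node l r) leaf         m eq with word-size (node l r) leaf m eq
... | ()
word-injective (node l r) (node l′ r′) m eq = cong₂ node l≡l′ r≡r′
  where
  same-top : suc (m + size r′ + size l′) ≡ suc (m + size r + size l)
  same-top = trans (size-node-offset m l′ r′)
    (trans (cong (m +_) (sym (word-size (node l r) (node l′ r′) m eq))) (sym (size-node-offset m l r)))
  parts : word l (m + size r) ≡ word l′ (m + size r′) × word r m ≡ word r′ m
  parts = ++-∷-injective (word l (m + size r)) (word l′ (m + size r′))
    (Split.left< (word-split l r m))
    (subst (λ M → All (_< M) (word l′ (m + size r′))) same-top (Split.left< (word-split l′ r′ m)))
    (trans eq (cong (λ M → word l′ (m + size r′) ++ M ∷ word r′ m) same-top))
  -- The offset of the left word contains the size of the right subtree, so the right subtrees are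
  -- identified first.
  r≡r′ : r ≡ r′
  r≡r′ = word-injective r r′ m (proj₂ parts)
  l≡l′ : l ≡ l′
  l≡l′ = word-injective l l′ (m + size r)
    (trans (proj₁ parts) (cong (λ t → word l′ (m + size t)) (sym r≡r′)))

-- Every 1-3-2-avoiding permutation is the word of a tree

unique-⊆-length : ∀ {A : Set} {xs ys : List A} → Unique xs → (∀ {x} → x ∈ xs → x ∈ ys) → length xs ≤ length ys
unique-⊆-length {xs = []}     _            _  = z≤n
unique-⊆-length {xs = x ∷ xs} (x∉xs ∷ uxs) ⊆ys with ∈ₚ.∈-∃++ (⊆ys (here refl))
... | ys₁ , ys₂ , refl = begin
  suc (length xs)                ≤⟨ s≤s (unique-⊆-length uxs removed) ⟩
  suc (length (ys₁ ++ ys₂))      ≡⟨ cong suc (Listₚ.length-++ ys₁) ⟩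
  suc (length ys₁ + length ys₂)  ≡⟨ ℕₚ.+-suc (length ys₁) (length ys₂) ⟨
  length ys₁ + suc (length ys₂)  ≡⟨ Listₚ.length-++ ys₁ ⟨
  length (ys₁ ++ x ∷ ys₂)        ∎
  where
  open ℕₚ.≤-Reasoning
  removed : ∀ {z} → z ∈ xs → z ∈ ys₁ ++ ys₂
  removed z∈xs with ∈ₚ.∈-++⁻ ys₁ (⊆ys (there z∈xs))
  ... | inj₁ z∈ys₁           = ∈ₚ.∈-++⁺ˡ z∈ys₁
  ... | inj₂ (here refl)     = ⊥-elim (All.lookup x∉xs z∈xs refl)
  ... | inj₂ (there z∈ys₂)   = ∈ₚ.∈-++⁺ʳ ys₁ z∈ys₂

pigeonhole : ∀ {lo hi xs} → Unique xs → All (InRange lo hi) xs → length xs ≤ hi ∸ lo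
pigeonhole {lo} {hi} {xs} uxs range = ℕₚ.≤-trans
  (unique-⊆-length uxs (λ x∈xs → member (All.lookup range x∈xs)))
  (ℕₚ.≤-reflexive (Listₚ.length-applyUpTo (λ i → suc (lo + i)) (hi ∸ lo)))
  where
  member : ∀ {x} → InRange lo hi x → x ∈ applyUpTo (λ i → suc (lo + i)) (hi ∸ lo)
  member {suc x} (s≤s lo≤x , x<hi) =
    subst (_∈ applyUpTo (λ i → suc (lo + i)) (hi ∸ lo)) (cong suc (ℕₚ.m+[n∸m]≡n lo≤x))
      (∈ₚ.∈-applyUpTo⁺ (λ i → suc (lo + i)) (ℕₚ.∸-monoˡ-< x<hi lo≤x))

-- Without the top value, n + 1 distinct letters would have only n values to take.
maximum∈ : ∀ {lo n w} → length w ≡ suc n → Unique w → All (InRange lo (lo + suc n)) w → lo + suc n ∈ w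
maximum∈ {lo} {n} {w} len uw range with lo + suc n ∈? w
... | yes M∈w = M∈w
... | no  M∉w = ⊥-elim (ℕₚ.1+n≰n (begin
  suc n         ≡⟨ len ⟨
  length w      ≤⟨ pigeonhole uw (All.tabulate smaller) ⟩
  lo + n ∸ lo   ≡⟨ ℕₚ.m+n∸m≡n lo n ⟩
  n             ∎))
  where
  open ℕₚ.≤-Reasoning
  smaller : ∀ {x} → x ∈ w → InRange lo (lo + n) x
  smaller {x} x∈w with All.lookup range x∈w
  ... | lo<x , x≤M = lo<x , ℕ.s≤s⁻¹ (subst (x <_) (ℕₚ.+-suc lo n)
    (ℕₚ.≤∧≢⇒< x≤M (λ x≡M → M∉w (subst (_∈ w) x≡M x∈w))))

unique-++⁻ : ∀ {A : Set} (xs : List A) {ys} → Unique (xs ++ ys) →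
  Unique xs × Unique ys × All (λ x → All (x ≢_) ys) xs
unique-++⁻ []       u          = [] , u , []
unique-++⁻ (x ∷ xs) (x∉ ∷ u) with unique-++⁻ xs u
... | uxs , uys , xs≢ys = Allₚ.++⁻ˡ xs x∉ ∷ uxs , uys , Allₚ.++⁻ʳ xs x∉ ∷ xs≢ys

∈∈⇒⊆ : ∀ {a M b : ℕ} {L R} → a ∈ L → b ∈ R → (a ∷ M ∷ b ∷ []) ⊆ L ++ M ∷ R
∈∈⇒⊆ a∈L b∈R = Sublistₚ.++⁺ (Sublist.from∈ a∈L) (refl ∷ Sublist.from∈ b∈R)

-- A letter a of L below a letter b of R would make a, M, b an occurrence of 1-3-2.
split-at-maximum : ∀ L {M R} → All (_≤ M) (L ++ M ∷ R) → Unique (L ++ M ∷ R) → Avoids132 (L ++ M ∷ R) → Split L M R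
split-at-maximum L {M} {R} ≤M u av with unique-++⁻ L u
... | _ , M∉R ∷ _ , L≢ = record
  { left<  = All.tabulate L<M
  ; right< = All.tabulate R<M
  ; cross  = All.tabulate (λ a∈L → All.tabulate (λ b∈R → R<L a∈L b∈R))
  }
  where
  L<M : ∀ {a} → a ∈ L → a < M
  L<M a∈L = ℕₚ.≤∧≢⇒< (All.lookup ≤M (∈ₚ.∈-++⁺ˡ a∈L)) (All.head (All.lookup L≢ a∈L))
  R<M : ∀ {b} → b ∈ R → b < M
  R<M b∈R = ℕₚ.≤∧≢⇒< (All.lookup ≤M (∈ₚ.∈-++⁺ʳ L (there b∈R))) (All.lookup M∉R b∈R ∘ sym)
  R<L : ∀ {a b} → a ∈ L → b ∈ R → b < a
  R<L {a} {b} a∈L b∈R = ℕₚ.≤∧≢⇒<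
    (ℕₚ.≮⇒≥ (λ a<b → av (∈∈⇒⊆ a∈L b∈R) a<b (R<M b∈R)))
    (λ b≡a → All.lookup (All.tail (All.lookup L≢ a∈L)) b∈R (sym b≡a))

-- The letters of R are below those of L, so counting them pins down both ranges.
module _ {L M R lo} (sp : Split L M R) (uL : Unique L) (uR : Unique R)
         (len : M ≡ suc (lo + length R + length L)) (range : All (lo <_) (L ++ M ∷ R)) where

  private
    below-M : ∀ {x} → x < M → x ≤ lo + length R + length L
    below-M x<M = ℕ.s≤s⁻¹ (subst (_ <_) len x<M)

  left-range : All (InRange (lo + length R) (lo + length R + length L)) L
  left-range = All.tabulate λ {a} a∈L → above a a∈L , below-M (All.lookup (Split.left< sp) a∈L)
    where
    above : ∀ a → a ∈ L → lo + length R < a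
    above zero    a∈L with All.lookup range (∈ₚ.∈-++⁺ˡ a∈L)
    ... | ()
    above (suc a) a∈L = s≤s (begin
      lo + length R     ≤⟨ ℕₚ.+-monoʳ-≤ lo (pigeonhole uR (All.tabulate λ b∈R →
                             All.lookup range (∈ₚ.∈-++⁺ʳ L (there b∈R)) ,
                             ℕ.s≤s⁻¹ (All.lookup (All.lookup (Split.cross sp) a∈L) b∈R))) ⟩
      lo + (a ∸ lo)     ≡⟨ ℕₚ.m+[n∸m]≡n (ℕ.s≤s⁻¹ (All.lookup range (∈ₚ.∈-++⁺ˡ a∈L))) ⟩
      a                 ∎)
      where open ℕₚ.≤-Reasoning

  right-range : All (InRange lo (lo + length R)) R
  right-range = All.tabulate λ {b} b∈R →
    All.lookup range (∈ₚ.∈-++⁺ʳ L (there b∈R)) ,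
    ℕₚ.+-cancelʳ-≤ (length L) b (lo + length R) (begin
      b + length L                         ≤⟨ ℕₚ.+-monoʳ-≤ b (pigeonhole uL (All.tabulate λ a∈L →
                                                All.lookup (All.lookup (Split.cross sp) a∈L) b∈R ,
                                                below-M (All.lookup (Split.left< sp) a∈L))) ⟩
      b + (lo + length R + length L ∸ b)   ≡⟨ ℕₚ.m+[n∸m]≡n (below-M (All.lookup (Split.right< sp) b∈R)) ⟩
      lo + length R + length L             ∎)
    where open ℕₚ.≤-Reasoning

avoids132-⊆ : ∀ {v w} → v ⊆ w → Avoids132 w → Avoids132 v
avoids132-⊆ v⊆w av s⊆v = av (⊆-trans s⊆v v⊆w)

-- The bound n on the length is there for termination.
tree-of-word : ∀ n w lo → length w ≤ n → Unique w → All (InRange lo (lo + length w)) w → Avoids132 w →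
  ∃ λ t → word t lo ≡ w
tree-of-word n       []         lo _   _  _     _  = leaf , refl
tree-of-word (suc n) w@(_ ∷ w′) lo len uw range av with ∈ₚ.∈-∃++ (maximum∈ refl uw range)
... | L , R , eq = node (proj₁ tL) (proj₁ tR) , (begin
    word (proj₁ tL) (lo + size (proj₁ tR)) ++ suc (lo + size (proj₁ tR) + size (proj₁ tL)) ∷ word (proj₁ tR) lo
      ≡⟨ cong₂ (λ r l → word (proj₁ tL) (lo + r) ++ suc (lo + r + l) ∷ word (proj₁ tR) lo) size-R size-L ⟩
    word (proj₁ tL) (lo + length R) ++ suc (lo + length R + length L) ∷ word (proj₁ tR) lo
      ≡⟨ cong₂ (λ u v → u ++ suc (lo + length R + length L) ∷ v) (proj₂ tL) (proj₂ tR) ⟩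
    L ++ suc (lo + length R + length L) ∷ R
      ≡⟨ cong (λ m → L ++ m ∷ R) M≡ ⟨
    L ++ M ∷ R
      ≡⟨ eq ⟨
    w ∎)
  where
  open ≡-Reasoning
  M : ℕ
  M = lo + length w
  length-w : length w ≡ suc (length R + length L)
  length-w = trans (cong length eq)
    (trans (Listₚ.length-++ L) (trans (ℕₚ.+-suc (length L) (length R)) (cong suc (ℕₚ.+-comm (length L) (length R)))))
  M≡ : M ≡ suc (lo + length R + length L)
  M≡ = trans (cong (lo +_) length-w) (trans (ℕₚ.+-suc lo (length R + length L)) (cong suc (sym (ℕₚ.+-assoc lo (length R) (length L)))))
  u : Unique (L ++ M ∷ R)
  u = subst Unique eq uw
  range′ : All (InRange lo M) (L ++ M ∷ R)
  range′ = subst (All (InRange lo M)) eq range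
  av′ : Avoids132 (L ++ M ∷ R)
  av′ = avoids132-⊆ (Sublist.⊆-reflexive (sym eq)) av
  uL : Unique L
  uL = proj₁ (unique-++⁻ L u)
  uR : Unique R
  uR = AllPairs.tail (proj₁ (proj₂ (unique-++⁻ L u)))
  sp : Split L M R
  sp = split-at-maximum L (All.map proj₂ range′) u av′
  len′ : length R + length L ≤ n
  len′ = ℕ.s≤s⁻¹ (ℕₚ.≤-trans (ℕₚ.≤-reflexive (sym length-w)) len)
  tL : ∃ λ t → word t (lo + length R) ≡ L
  tL = tree-of-word n L (lo + length R) (ℕₚ.≤-trans (ℕₚ.m≤n+m _ (length R)) len′) uL
    (left-range sp uL uR M≡ (All.map proj₁ range′))
    (avoids132-⊆ (Sublistₚ.++⁺ʳ (M ∷ R) ⊆-refl) av′)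
  tR : ∃ λ t → word t lo ≡ R
  tR = tree-of-word n R lo (ℕₚ.≤-trans (ℕₚ.m≤m+n _ (length L)) len′) uR
    (right-range sp uL uR M≡ (All.map proj₁ range′))
    (avoids132-⊆ (Sublistₚ.++⁺ˡ L (M ∷ʳ ⊆-refl)) av′)
  size-L : size (proj₁ tL) ≡ length L
  size-L = trans (sym (length-word (proj₁ tL) (lo + length R))) (cong length (proj₂ tL))
  size-R : size (proj₁ tR) ≡ length R
  size-R = trans (sym (length-word (proj₁ tR) lo)) (cong length (proj₂ tR))

-- Complete, duplicate-free lists of trees and of words

module _ {A : Set} where

  ∈-concatTo⁺ : ∀ n {F : ℕ → List A} {i x} → i ≤ n → x ∈ F i → x ∈ concatTo n F
  ∈-concatTo⁺ zero    z≤n x∈ = x∈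
  ∈-concatTo⁺ (suc n) {F} {i} i≤1+n x∈ with ℕₚ.m≤n⇒m<n∨m≡n i≤1+n
  ... | inj₁ (s≤s i≤n) = ∈ₚ.∈-++⁺ˡ (∈-concatTo⁺ n i≤n x∈)
  ... | inj₂ refl      = ∈ₚ.∈-++⁺ʳ (concatTo n F) x∈

  ∈-concatTo⁻ : ∀ n {F : ℕ → List A} {x} → x ∈ concatTo n F → ∃ λ i → i ≤ n × x ∈ F i
  ∈-concatTo⁻ zero    x∈ = 0 , z≤n , x∈
  ∈-concatTo⁻ (suc n) {F} x∈ with ∈ₚ.∈-++⁻ (concatTo n F) x∈
  ... | inj₁ x∈′ = let i , i≤n , x∈F = ∈-concatTo⁻ n x∈′ in i , ℕₚ.m≤n⇒m≤1+n i≤n , x∈F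
  ... | inj₂ x∈′ = suc n , ℕₚ.≤-refl , x∈′

  -- The key reveals the block an element comes from, so the blocks are disjoint. For trees it is
  -- the size of the left subtree.
  concatTo-unique : ∀ n {F : ℕ → List A} (key : A → ℕ) → (∀ i {x} → x ∈ F i → key x ≡ i) →
    (∀ i → Unique (F i)) → Unique (concatTo n F)
  concatTo-unique zero    key key≡ u = u 0
  concatTo-unique (suc n) {F} key key≡ u = Uniqueₚ.++⁺ (concatTo-unique n key key≡ u) (u (suc n))
    λ (x∈₁ , x∈₂) → let i , i≤n , x∈ = ∈-concatTo⁻ n x∈₁ in
      ℕₚ.<⇒≢ (s≤s i≤n) (trans (sym (key≡ i x∈)) (key≡ (suc n) x∈₂))

treesUpTo-size : ∀ N n {t} → t ∈ treesUpTo N n → size t ≡ n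
treesUpTo-size zero    zero    (here refl) = refl
treesUpTo-size (suc N) zero    (here refl) = refl
treesUpTo-size (suc N) (suc n) t∈ with ∈-concatTo⁻ n t∈
... | i , i≤n , t∈′ with ∈ₚ.∈-cartesianProductWith⁻ node (treesUpTo N i) (treesUpTo N (n ∸ i)) t∈′
... | l , r , l∈ , r∈ , refl = cong suc
  (trans (cong₂ _+_ (treesUpTo-size N i l∈) (treesUpTo-size N (n ∸ i) r∈)) (ℕₚ.m+[n∸m]≡n i≤n))

∈-treesUpTo : ∀ N t → size t ≤ N → t ∈ treesUpTo N (size t)
∈-treesUpTo zero    leaf       _       = here refl
∈-treesUpTo (suc N) leaf       _       = here refl
∈-treesUpTo (suc N) (node l r) (s≤s h) = ∈-concatTo⁺ (size l + size r) (ℕₚ.m≤m+n (size l) (size r))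
  (∈ₚ.∈-cartesianProductWith⁺ node
    (∈-treesUpTo N l (ℕₚ.≤-trans (ℕₚ.m≤m+n (size l) (size r)) h))
    (subst (λ s → r ∈ treesUpTo N s) (sym (ℕₚ.m+n∸m≡n (size l) (size r)))
      (∈-treesUpTo N r (ℕₚ.≤-trans (ℕₚ.m≤n+m (size r) (size l)) h))))

treesUpTo-unique : ∀ N n → Unique (treesUpTo N n)
treesUpTo-unique N       zero    = [] ∷ []
treesUpTo-unique zero    (suc n) = []
treesUpTo-unique (suc N) (suc n) = concatTo-unique n leftSize left≡ λ i →
  Uniqueₚ.cartesianProductWith⁺ node (λ where refl → refl , refl) (treesUpTo-unique N i) (treesUpTo-unique N (n ∸ i))
  where
  leftSize : Tree → ℕ
  leftSize leaf       = 0
  leftSize (node l r) = size l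
  left≡ : ∀ i {t} → t ∈ cartesianProductWith node (treesUpTo N i) (treesUpTo N (n ∸ i)) → leftSize t ≡ i
  left≡ i t∈ with ∈ₚ.∈-cartesianProductWith⁻ node (treesUpTo N i) (treesUpTo N (n ∸ i)) t∈
  ... | l , r , l∈ , r∈ , refl = treesUpTo-size N i l∈

words-suc : ∀ m A → words (suc m) A ≡ cartesianProductWith _∷_ A (words m A)
words-suc m A = go A
  where
  go : ∀ B → concatMap (λ a → map (a ∷_) (words m A)) B ≡ cartesianProductWith _∷_ B (words m A)
  go []      = refl
  go (b ∷ B) = cong (map (b ∷_) (words m A) ++_) (go B)

∈-words⁺ : ∀ {A w} → All (_∈ A) w → w ∈ words (length w) A
∈-words⁺ []                             = here refl
∈-words⁺ {A} {a ∷ w} (a∈A ∷ w∈A) rewrite words-suc (length w) A =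
  ∈ₚ.∈-cartesianProductWith⁺ _∷_ a∈A (∈-words⁺ w∈A)

∈-words⁻ : ∀ n {A w} → w ∈ words n A → length w ≡ n × All (_∈ A) w
∈-words⁻ zero    (here refl) = refl , []
∈-words⁻ (suc n) {A} w∈ rewrite words-suc n A with ∈ₚ.∈-cartesianProductWith⁻ _∷_ A (words n A) w∈
... | a , w , a∈A , w∈′ , refl = let len , all = ∈-words⁻ n w∈′ in cong suc len , a∈A ∷ all

words-unique : ∀ n {A} → Unique A → Unique (words n A)
words-unique zero    uA = [] ∷ []
words-unique (suc n) {A} uA rewrite words-suc n A =
  Uniqueₚ.cartesianProductWith⁺ _∷_ (λ where refl → refl , refl) uA (words-unique n uA)

letters : ℕ → List ℕ
letters n = map suc (upTo n)

∈-letters⁺ : ∀ {n x} → InRange 0 n x → x ∈ letters n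
∈-letters⁺ {n} {suc x} (_ , x<n) = ∈ₚ.∈-map⁺ suc (∈ₚ.∈-upTo⁺ x<n)

∈-letters⁻ : ∀ {n x} → x ∈ letters n → InRange 0 n x
∈-letters⁻ x∈ with ∈ₚ.∈-map⁻ suc x∈
... | y , y∈ , refl = s≤s z≤n , ∈ₚ.∈-upTo⁻ y∈

avoider : List ℕ → Bool
avoider w = distinct w ∧ (occurrences p132 w ≡ᵇ 0)

-- Two duplicate-free lists with the same members are rearrangements of each other, and `count-↭`
-- then carries every count from permutations to trees.
avoiders↭trees : ∀ n → filterᵇ avoider (words n (letters n)) ↭ map (λ t → word t 0) (trees n)
avoiders↭trees n = ∼bag⇒↭ (unique∧set⇒bag
  (Uniqueₚ.filter⁺ (T? ∘ avoider) (words-unique n (Uniqueₚ.map⁺ ℕₚ.suc-injective (Uniqueₚ.upTo⁺ n))))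
  (Uniqueₚ.map⁺ (λ {t} {t′} → word-injective t t′ 0) (treesUpTo-unique n n))
  (mk⇔ to from))
  where
  to : ∀ {w} → w ∈ filterᵇ avoider (words n (letters n)) → w ∈ map (λ t → word t 0) (trees n)
  to {w} w∈ with ∈ₚ.∈-filter⁻ (T? ∘ avoider) {xs = words n (letters n)} w∈
  ... | w∈words , good with ∈-words⁻ n w∈words | Equivalence.to (T-∧ {distinct w}) good
  ... | refl , all | dist , av with
    tree-of-word n w 0 ℕₚ.≤-refl (distinct⁻ w dist) (All.map ∈-letters⁻ all) (avoids132⁻ w av)
  ... | t , refl = ∈ₚ.∈-map⁺ (λ t → word t 0)
    (subst (λ s → t ∈ treesUpTo s s) (sym (length-word t 0)) (∈-treesUpTo (size t) t ℕₚ.≤-refl))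
  from : ∀ {w} → w ∈ map (λ t → word t 0) (trees n) → w ∈ filterᵇ avoider (words n (letters n))
  from w∈ with ∈ₚ.∈-map⁻ (λ t → word t 0) w∈
  ... | t , t∈ , refl with treesUpTo-size n n t∈
  ... | refl = ∈ₚ.∈-filter⁺ (T? ∘ avoider)
    (subst (λ k → word t 0 ∈ words k (letters (size t))) (length-word t 0)
      (∈-words⁺ (All.map ∈-letters⁺ (word-range t 0))))
    (Equivalence.from (T-∧ {distinct (word t 0)}) (distinct⁺ (word-unique t 0) , avoids132⁺ (word t 0) (word-avoids132 t 0)))

module _ {A : Set} where

  count-filterᵇ : ∀ (p q : A → Bool) xs → count p (filterᵇ q xs) ≡ count (λ x → q x ∧ p x) xs
  count-filterᵇ p q []       = refl
  count-filterᵇ p q (x ∷ xs) with q x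
  ... | false = count-filterᵇ p q xs
  ... | true  rewrite count-filterᵇ p q xs = refl

  count-↭ : ∀ (p : A → Bool) {xs ys} → xs ↭ ys → count p xs ≡ count p ys
  count-↭ p Perm.refl         = refl
  count-↭ p (Perm.prep x e)   rewrite count-↭ p e = refl
  count-↭ p (Perm.swap x y e) rewrite count-↭ p e with p x | p y
  ... | true  | true  = refl
  ... | true  | false = refl
  ... | false | true  = refl
  ... | false | false = refl
  count-↭ p (Perm.trans e f)  = trans (count-↭ p e) (count-↭ p f)

-- From counts of permutations to generating functions

fromℕℚ-suc : ∀ n → fromℕℚ (suc n) ≡ 1ℚ ℚ.+ fromℕℚ n
fromℕℚ-suc n = ℚₚ.toℚᵘ-injective (begin
  ℚ.toℚᵘ (fromℕℚ (suc n))               ≈⟨ ℚₚ.toℚᵘ-fromℚᵘ (ℚᵘ.mkℚᵘ (ℤ.+ suc n) 0) ⟩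
  ℚᵘ.mkℚᵘ (ℤ.+ suc n) 0                   ≈⟨ ℚᵘ.*≡* (cong (λ i → (ℤ.+ 1 ℤ.+ i) ℤ.* ℤ.+ 1) (sym (ℤₚ.*-identityʳ (ℤ.+ n)))) ⟩
  ℚᵘ.1ℚᵘ ℚᵘ.+ ℚᵘ.mkℚᵘ (ℤ.+ n) 0           ≈⟨ ℚᵘₚ.+-congʳ ℚᵘ.1ℚᵘ (ℚₚ.toℚᵘ-fromℚᵘ (ℚᵘ.mkℚᵘ (ℤ.+ n) 0)) ⟨
  ℚᵘ.1ℚᵘ ℚᵘ.+ ℚ.toℚᵘ (fromℕℚ n)         ≈⟨ ℚₚ.toℚᵘ-homo-+ 1ℚ (fromℕℚ n) ⟨
  ℚ.toℚᵘ (1ℚ ℚ.+ fromℕℚ n)              ∎)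
  where open import Relation.Binary.Reasoning.Setoid ℚᵘₚ.≃-setoid

fromℕℚ-count : ∀ {A : Set} (p : A → Bool) xs → fromℕℚ (count p xs) ≡ sumOver (indicator ∘ p) xs
fromℕℚ-count p []       = refl
fromℕℚ-count p (x ∷ xs) with p x
... | true  = trans (fromℕℚ-suc (count p xs)) (cong (1ℚ ℚ.+_) (fromℕℚ-count p xs))
... | false = trans (fromℕℚ-count p xs) (sym (ℚₚ.+-identityˡ _))

countClass-trees : ∀ C k n → countClass C k n ≡ count (λ t → C (word t 0) ∧ once k t) (trees n)
countClass-trees C k n = begin
  countClass C k n
    ≡⟨ count-filterᵇ _ distinct (words n (letters n)) ⟩
  count (λ π → distinct π ∧ (C π ∧ (occurrences p132 π ≡ᵇ 0) ∧ E π)) (words n (letters n))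
    ≡⟨ count-cong (λ π → bools (distinct π) (C π) (occurrences p132 π ≡ᵇ 0) (E π)) (words n (letters n)) ⟩
  count (λ π → avoider π ∧ (C π ∧ E π)) (words n (letters n))
    ≡⟨ count-filterᵇ _ avoider (words n (letters n)) ⟨
  count (λ π → C π ∧ E π) (filterᵇ avoider (words n (letters n)))
    ≡⟨ count-↭ _ (avoiders↭trees n) ⟩
  count (λ π → C π ∧ E π) (map (λ t → word t 0) (trees n))
    ≡⟨ count-map _ (λ t → word t 0) (trees n) ⟩
  count (λ t → C (word t 0) ∧ E (word t 0)) (trees n)
    ≡⟨ count-cong (λ t → cong (λ i → C (word t 0) ∧ (i ≡ᵇ 1)) (occurrences-word k t 0)) (trees n) ⟩
  count (λ t → C (word t 0) ∧ once k t) (trees n) ∎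
  where
  open ≡-Reasoning
  E : List ℕ → Bool
  E π = occurrences (incPat k) π ≡ᵇ 1
  bools : ∀ d c o e → d ∧ (c ∧ o ∧ e) ≡ (d ∧ o) ∧ (c ∧ e)
  bools false c     o     e = refl
  bools true  false false e = refl
  bools true  false true  e = refl
  bools true  true  o     e = refl

-- An occurrence of a pattern with at least two letters forces length at least two. This reconciles
-- the tree shapes, which admit the short words that the recurrences start from, with the classes,
-- which are empty there.
atLeast2-once : ∀ j t b → (atLeast2 (size t) ∧ b) ∧ once (suc (suc j)) t ≡ b ∧ once (suc (suc j)) t
atLeast2-once j leaf b                    = sym (∧-zeroʳ b)
atLeast2-once zero    (node leaf leaf) b  = sym (∧-zeroʳ b)
atLeast2-once (suc j) (node leaf leaf) b  = sym (∧-zeroʳ b)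
atLeast2-once j (node leaf (node _ _)) b  = refl
atLeast2-once j (node (node _ _) _) b     = refl

genFun-trees : ∀ (C : List ℕ → Bool) (S : Tree → Bool) (b : List ℕ → Bool) j →
  (∀ π → C π ≡ atLeast2 (length π) ∧ b π) → (∀ t → b (word t 0) ≡ S t) →
  genFun (countClass C (suc (suc j))) ≈ series (containing S (suc (suc j)))
genFun-trees C S b j C≡ b≡ n = begin
  fromℕℚ (countClass C k n)
    ≡⟨ cong fromℕℚ (countClass-trees C k n) ⟩
  fromℕℚ (count (λ t → C (word t 0) ∧ once k t) (trees n))
    ≡⟨ cong fromℕℚ (count-cong pointwise (trees n)) ⟩
  fromℕℚ (count (λ t → S t ∧ once k t) (trees n))
    ≡⟨ fromℕℚ-count (λ t → S t ∧ once k t) (trees n) ⟩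
  sumOver (containing S k) (trees n) ∎
  where
  open ≡-Reasoning
  k = suc (suc j)
  pointwise : ∀ t → C (word t 0) ∧ once k t ≡ S t ∧ once k t
  pointwise t = begin
    C (word t 0) ∧ once k t
      ≡⟨ cong (_∧ once k t) (C≡ (word t 0)) ⟩
    (atLeast2 (length (word t 0)) ∧ b (word t 0)) ∧ once k t
      ≡⟨ cong₂ (λ s u → (atLeast2 s ∧ u) ∧ once k t) (length-word t 0) (b≡ t) ⟩
    (atLeast2 (size t) ∧ S t) ∧ once k t
      ≡⟨ atLeast2-once j t (S t) ⟩
    S t ∧ once k t ∎

ud-series : ∀ j → genFun (ud (suc (suc j))) ≈ series (containing oddUp (suc (suc j)))
ud-series j = genFun-trees upDown oddUp (λ π → isOdd (length π) ∧ alt true π) j (λ _ → refl)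
  (λ t → trans (cong (λ s → isOdd s ∧ alt true (word t 0)) (length-word t 0)) (oddUp-word t 0))

uu-series : ∀ j → genFun (uu (suc (suc j))) ≈ series (containing evenUp (suc (suc j)))
uu-series j = genFun-trees upUp evenUp (λ π → not (isOdd (length π)) ∧ alt true π) j (λ _ → refl)
  (λ t → trans (cong (λ s → not (isOdd s) ∧ alt true (word t 0)) (length-word t 0)) (evenUp-word t 0))

dd-series : ∀ j → genFun (dd (suc (suc j))) ≈ series (containing evenDown (suc (suc j)))
dd-series j = genFun-trees downDown evenDown (λ π → not (isOdd (length π)) ∧ alt false π) j (λ _ → refl)
  (λ t → trans (cong (λ s → not (isOdd s) ∧ alt false (word t 0)) (length-word t 0)) (evenDown-word t 0))

du-series : ∀ j → genFun (du (suc (suc j))) ≈ series (containing oddDown (suc (suc j)))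
du-series j = genFun-trees downUp oddDown (λ π → isOdd (length π) ∧ alt false π) j (λ _ → refl)
  (λ t → trans (cong (λ s → isOdd s ∧ alt false (word t 0)) (length-word t 0)) (oddDown-word t 0))

-- Assembly of the four formulas

open Solution Laurent-commutativeRing recurrences using (A-V; B-V; C-V; D-V; q-V) renaming (q to summand)

≈/-congˡ : ∀ f g v w → f ≈ g → g ≈ v / w → f ≈ v / w
≈/-congˡ f g v w f≈g g≈ = ≈-trans (f ⊛ w) (g ⊛ w) v (⊛-cong f g w w f≈g (λ _ → refl)) g≈

theorem3p1 : (k : ℕ) → 2 ≤ k →
    (genFun (ud k) ≈ xL / (Uₓ (k ∸ 1) ⊛ Uₓ (k ∸ 1)))
    × (genFun (uu k) ≈ oneL / (Uₓ (k ∸ 1) ⊛ Uₓ (k ∸ 1)))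
    × ∃ (λ q →
    (∀ m → m ≤ k ∸ 2 →
    q m ≈ (xL ^L (k ∸ 1 ∸ m)) ⊛ ((xL ^L (m + 1)) ⊕ Uₓprev m) / (Uₓ m ⊛ Uₓ (suc m)))
    × (genFun (dd k) ≈ sumL (map q (upTo (k ∸ 1))) / Uₓ (k ∸ 1))
    × (genFun (du k) ≈ sumL (map q (upTo (k ∸ 1))) / (xL ⊛ Uₓ (k ∸ 1))))
theorem3p1 (suc zero)    (s≤s ())
theorem3p1 (suc (suc j)) _ =
  ≈/-congˡ (genFun (ud k)) (series (containing oddUp k)) xL (u ⊛ u) (ud-series j) (A-V (suc j)) ,
  ≈/-congˡ (genFun (uu k)) (series (containing evenUp k)) oneL (u ⊛ u) (uu-series j) (B-V j) ,
  -- The quotients under the sum must be exhibited as Laurent series. These are products of powers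
  -- of x, generating functions and a Chebyshev factor, so no division is performed; the index
  -- `suc j` is k - 1.
  summand (suc j) ,
  (λ m _ → subst (λ e → summand (suc j) m ≈ (xL ^L (suc j ∸ m)) ⊛ ((xL ^L e) ⊕ Uₓprev m) / (Uₓ m ⊛ Uₓ (suc m)))
             (ℕₚ.+-comm 1 m) (q-V (suc j) m)) ,
  ≈/-congˡ (genFun (dd k)) (series (containing evenDown k)) s u (dd-series j) (C-V (suc j)) ,
  ≈/-congˡ (genFun (du k)) (series (containing oddDown k)) s (xL ⊛ u) (du-series j)
    (≈-trans (series (containing oddDown k) ⊛ (xL ⊛ u)) (series (containing evenDown k) ⊛ u) s (D-V j) (C-V (suc j)))
  where
  k = suc (suc j)
  u = Uₓ (suc j)
  s = sumL (map (summand (suc j)) (upTo (suc j)))
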